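{- Let $p$ be an odd prime and $a\in\mathbb Z_p$ with $a\not\equiv0,\pm1\pmod p$. Then $$\sum_{k=0}^{p-1}\binom ak\binom{ -1-a}k\binom{2k}k\frac1{4^k(a+k)}\equiv\frac1{2a}S_p(a)+\frac{(a+1)^2}{2a^3}S_p(a+1)$$ $$\equiv\frac{a+1}{2a^2}\sum_{k=0}^{p-2}\binom ak\binom{ -1-a}k\binom{2k}k\frac1{4^k(k+1)}-\frac1{2a^2}S_p(a)\pmod{p^3},$$ and $$\sum_{k=0}^{p-1}\binom ak\binom{ -1-a}k\binom{2k}k\frac1{4^k(a+k-1)}\equiv\frac{(a-1)^2+1}{2(a-1)^3}S_p(a)+\frac{(a+1)^2}{2a^2(a-1)}S_p(a+1)$$ $$\equiv\frac{a+1}{2a(a-1)}\sum_{k=0}^{p-2}\binom ak\binom{ -1-a}k\binom{2k}k\frac1{4^k(k+1)}-\frac{a^2-3a+1}{2a(a-1)^3}S_p(a)\pmod{p^3}.$$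
   Context: For a prime $p$, $\mathbb Z_p$ denotes the set of rational numbers whose denominator is not divisible by $p$, and congruences modulo powers of $p$ are between elements of $\mathbb Z_p$ (the difference divided by that power of $p$ lies in $\mathbb Z_p$). For rational $a$ and integer $k\ge0$, $\binom ak=a(a-1)\cdots(a-k+1)/k!$. Define $S_n(a)=\sum_{k=0}^{n-1}\binom ak\binom{ -1-a}k\binom{2k}k\frac1{4^k}$ for $n\ge1$. -}

module Defs where

open import Data.Integer.Base as ℤ using (+_)
import Data.Integer.Properties as ℤ
open import Data.Nat.Base as ℕ using (ℕ; zero; suc; _!)
open import Data.Nat.Combinatorics using (_C_)
open import Data.Nat.Divisibility using (_∤_)
open import Data.Nat.Properties using (_!≢0)
open import Data.Product.Base using (_×_)
open import Data.Rational.Base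
open import Data.Rational.Properties
open import Data.Rational.Solver using (module +-*-Solver)
import Data.Rational.Unnormalised.Base as ℚᵘ
import Data.Rational.Unnormalised.Properties as ℚᵘ
open import Relation.Nullary.Decidable using (yes; no)
open import Relation.Nullary.Negation using (contradiction)
open import Relation.Binary.PropositionalEquality
open import Algebra.Definitions.RawSemiring +-*-rawSemiring public using (_^_)

infix  4 _≡_[mod_^_]
infix  4 _∈ℤ₍_₎
infixl 7 _÷₀_
infix  6 _÷_or_
infix  5 ∑<

ι : ℕ → ℚ
ι n = + n / 1

-- The quotient x / y if y ≠ 0, and v if y = 0.
_÷_or_ : ℚ → ℚ → ℚ → ℚ
x ÷ y or v with y ≟ 0ℚ
... | yes _   = v
... | no  y≢0 = (x ÷ y) {{≢-nonZero y≢0}}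

_÷₀_ : ℚ → ℚ → ℚ
x ÷₀ y = x ÷ y or 0ℚ

∑< : ℕ → (ℕ → ℚ) → ℚ
∑< zero    f = 0ℚ
∑< (suc n) f = ∑< n f + f n

syntax ∑< n (λ k → t) = ∑[ k < n ] t

-- Elements of ℚ are in lowest terms, so ↧ₙ x is the reduced denominator.
_∈ℤ₍_₎ : ℚ → ℕ → Set
x ∈ℤ₍ p ₎ = p ∤ ↧ₙ x

_≡_[mod_^_] : ℚ → ℚ → ℕ → ℕ → Set
x ≡ y [mod p ^ m ] =
  x ∈ℤ₍ p ₎ × y ∈ℤ₍ p ₎ × ((x - y) ÷₀ ι p ^ m) ∈ℤ₍ p ₎

-- a (a - 1) ⋯ (a - k + 1)
falling : ℚ → ℕ → ℚ
falling a zero    = 1ℚ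
falling a (suc k) = falling a k * (a - ι k)

binom : ℚ → ℕ → ℚ
binom a k = falling a k ÷₀ ι (k !)

central : ℕ → ℚ
central k = ι ((2 ℕ.* k) C k) ÷₀ ι 4 ^ k

term : ℚ → ℕ → ℚ
term a k = binom a k * binom (- 1ℚ - a) k * central k

S : ℕ → ℚ → ℚ
S n a = ∑[ k < n ] term a k

-- The numerator of binom (-1 - a) k is (-1)ᵏ (a + 1) ⋯ (a + k).  It contains
-- the factor a + k when k ≥ 1 and the factor a + k - 1 when k ≥ 2, so
-- term a k / (a + k) and term a k / (a + k - 1) still have a value when the
-- divisor vanishes: the one obtained by cancelling that factor.  The functions
-- binom/₀ and binom/₁ are binom (-1 - a) k with the factor a + k, respectively
-- a + k - 1, cancelled (see binom/₀-correct and binom/₁-correct).  Their values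
-- at k = 0, and at k = 1 for binom/₁, are junk: there the divisor is a, a - 1
-- or a, which is nonzero when a ≢ 0, 1 (mod p).
binom/₀ : ℚ → ℕ → ℚ
binom/₀ a zero    = 0ℚ
binom/₀ a (suc k) = - (binom (- 1ℚ - a) k ÷₀ ι (suc k))

binom/₁ : ℚ → ℕ → ℚ
binom/₁ a zero          = 0ℚ
binom/₁ a (suc zero)    = 0ℚ
binom/₁ a (suc (suc k)) =
  (a + ι (2 ℕ.+ k)) * (binom (- 1ℚ - a) k ÷₀ (ι (2 ℕ.+ k) * ι (1 ℕ.+ k)))

term/₀ : ℚ → ℕ → ℚ
term/₀ a k = term a k ÷ (a + ι k) or (binom a k * binom/₀ a k * central k)

term/₁ : ℚ → ℕ → ℚ
term/₁ a k =
  term a k ÷ (a + ι k - 1ℚ) or (binom a k * binom/₁ a k * central k)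

÷₀-*-cancel : ∀ x y → y ≢ 0ℚ → (x ÷₀ y) * y ≡ x
÷₀-*-cancel x y y≢0 with y ≟ 0ℚ
... | yes y≡0 = contradiction y≡0 y≢0
... | no  ¬p  = trans (*-assoc x _ y)
  (trans (cong (x *_) (*-inverseˡ y {{≢-nonZero ¬p}})) (*-identityʳ x))

*-cancelʳ-≢0 : ∀ x y z → z ≢ 0ℚ → x * z ≡ y * z → x ≡ y
*-cancelʳ-≢0 x y z z≢0 eq = begin
  x             ≡⟨ lem x ⟨
  x * z * 1/z   ≡⟨ cong (_* 1/z) eq ⟩
  y * z * 1/z   ≡⟨ lem y ⟩
  y             ∎
  where
  open ≡-Reasoning
  instance _ = ≢-nonZero z≢0
  1/z : ℚ
  1/z = 1/ z
  lem : ∀ w → w * z * 1/z ≡ w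
  lem w = trans (*-assoc w z 1/z)
    (trans (cong (w *_) (*-inverseʳ z)) (*-identityʳ w))

ι-* : ∀ m n → ι (m ℕ.* n) ≡ ι m * ι n
ι-* m n = toℚᵘ-injective (begin
  toℚᵘ (ι (m ℕ.* n))         ≈⟨ toℚᵘ-fromℚᵘ (ℚᵘ.mkℚᵘ (+ (m ℕ.* n)) 0) ⟩
  ℚᵘ.mkℚᵘ (+ (m ℕ.* n)) 0    ≈⟨ ℚᵘ.*≡* (cong (λ i → i ℤ.* + 1) (ℤ.pos-* m n)) ⟩
  ℚᵘ.mkℚᵘ (+ m) 0 ℚᵘ.* ℚᵘ.mkℚᵘ (+ n) 0
    ≈⟨ ℚᵘ.*-cong (toℚᵘ-fromℚᵘ (ℚᵘ.mkℚᵘ (+ m) 0)) (toℚᵘ-fromℚᵘ (ℚᵘ.mkℚᵘ (+ n) 0)) ⟨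
  toℚᵘ (ι m) ℚᵘ.* toℚᵘ (ι n) ≈⟨ toℚᵘ-homo-* (ι m) (ι n) ⟨
  toℚᵘ (ι m * ι n)           ∎)
  where open ℚᵘ.≃-Reasoning

ι-suc : ∀ n → ι (suc n) ≡ 1ℚ + ι n
ι-suc n = toℚᵘ-injective (begin
  toℚᵘ (ι (suc n))           ≈⟨ toℚᵘ-fromℚᵘ (ℚᵘ.mkℚᵘ (+ suc n) 0) ⟩
  ℚᵘ.mkℚᵘ (+ suc n) 0        ≈⟨ ℚᵘ.*≡* (cong (λ i → (+ 1 ℤ.+ i) ℤ.* + 1) (sym (ℤ.*-identityʳ (+ n)))) ⟩
  ℚᵘ.1ℚᵘ ℚᵘ.+ ℚᵘ.mkℚᵘ (+ n) 0
    ≈⟨ ℚᵘ.+-congʳ ℚᵘ.1ℚᵘ (toℚᵘ-fromℚᵘ (ℚᵘ.mkℚᵘ (+ n) 0)) ⟨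
  ℚᵘ.1ℚᵘ ℚᵘ.+ toℚᵘ (ι n)     ≈⟨ toℚᵘ-homo-+ 1ℚ (ι n) ⟨
  toℚᵘ (1ℚ + ι n)            ∎)
  where open ℚᵘ.≃-Reasoning

ι≢0 : ∀ n .{{_ : ℕ.NonZero n}} → ι n ≢ 0ℚ
ι≢0 (suc n) eq with subst Positive eq (normalize-pos (suc n) 1)
... | ()

binom-suc : ∀ x k → binom x (suc k) * ι (suc k) ≡ binom x k * (x - ι k)
binom-suc x k = *-cancelʳ-≢0 _ _ (ι (k !)) (ι≢0 (k !) {{k !≢0}}) (begin
  binom x (suc k) * ι (suc k) * ι (k !)     ≡⟨ *-assoc (binom x (suc k)) _ _ ⟩
  binom x (suc k) * (ι (suc k) * ι (k !))   ≡⟨ cong (binom x (suc k) *_) (ι-* (suc k) (k !)) ⟨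
  binom x (suc k) * ι (suc k !)             ≡⟨ ÷₀-*-cancel _ _ (ι≢0 (suc k !) {{suc k !≢0}}) ⟩
  falling x k * (x - ι k)                   ≡⟨ cong (_* (x - ι k)) (÷₀-*-cancel (falling x k) _ (ι≢0 (k !) {{k !≢0}})) ⟨
  binom x k * ι (k !) * (x - ι k)           ≡⟨ solve 3 (λ b f y → b :* f :* y := b :* y :* f) refl (binom x k) (ι (k !)) (x - ι k) ⟩
  binom x k * (x - ι k) * ι (k !)           ∎)
  where
  open ≡-Reasoning
  open +-*-Solver

binom/₀-correct : ∀ a k →
  binom/₀ a (suc k) * (a + ι (suc k)) ≡ binom (- 1ℚ - a) (suc k)
binom/₀-correct a k = *-cancelʳ-≢0 _ _ s (ι≢0 (suc k)) (begin
  - q * (a + s) * s              ≡⟨ solve 3 (λ q a s → (:- q) :* (a :+ s) :* s := (:- (q :* s)) :* (a :+ s)) refl q a s ⟩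
  - (q * s) * (a + s)            ≡⟨ cong₂ (λ u v → - u * (a + v)) (÷₀-*-cancel b s (ι≢0 (suc k))) (ι-suc k) ⟩
  - b * (a + (1ℚ + ι k))         ≡⟨ solve 3 (λ b a i → (:- b) :* (a :+ (con 1ℚ :+ i)) := b :* ((con (- 1ℚ) :- a) :- i)) refl b a (ι k) ⟩
  b * (- 1ℚ - a - ι k)           ≡⟨ binom-suc (- 1ℚ - a) k ⟨
  binom (- 1ℚ - a) (suc k) * s   ∎)
  where
  open ≡-Reasoning
  open +-*-Solver
  s b q : ℚ
  s = ι (suc k)
  b = binom (- 1ℚ - a) k
  q = b ÷₀ s

binom/₁-correct : ∀ a k →
  binom/₁ a (2 ℕ.+ k) * (a + ι (2 ℕ.+ k) - 1ℚ) ≡ binom (- 1ℚ - a) (2 ℕ.+ k)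
binom/₁-correct a k = *-cancelʳ-≢0 _ _ (t * s) ts≢0 (begin
  (a + t) * q * (a + t - 1ℚ) * (t * s)
    ≡⟨ solve 4 (λ a t q m → (a :+ t) :* q :* (a :+ t :- con 1ℚ) :* m := (q :* m) :* (a :+ t) :* (a :+ t :- con 1ℚ)) refl a t q (t * s) ⟩
  q * (t * s) * (a + t) * (a + t - 1ℚ)
    ≡⟨ cong₂ (λ u v → u * (a + v) * (a + v - 1ℚ)) (÷₀-*-cancel b (t * s) ts≢0) (ι-suc (suc k)) ⟩
  b * (a + (1ℚ + s)) * (a + (1ℚ + s) - 1ℚ)
    ≡⟨ cong (λ v → b * (a + (1ℚ + s)) * (a + (1ℚ + v) - 1ℚ)) (ι-suc k) ⟩
  b * (a + (1ℚ + s)) * (a + (1ℚ + (1ℚ + ι k)) - 1ℚ)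
    ≡⟨ solve 4 (λ b a s i → b :* (a :+ (con 1ℚ :+ s)) :* (a :+ (con 1ℚ :+ (con 1ℚ :+ i)) :- con 1ℚ) := (b :* ((con (- 1ℚ) :- a) :- i)) :* ((con (- 1ℚ) :- a) :- s)) refl b a s (ι k) ⟩
  b * (- 1ℚ - a - ι k) * (- 1ℚ - a - s)
    ≡⟨ cong (_* (- 1ℚ - a - s)) (binom-suc (- 1ℚ - a) k) ⟨
  b′ * s * (- 1ℚ - a - s)
    ≡⟨ solve 3 (λ b s y → b :* s :* y := b :* y :* s) refl b′ s (- 1ℚ - a - s) ⟩
  b′ * (- 1ℚ - a - s) * s
    ≡⟨ cong (_* s) (binom-suc (- 1ℚ - a) (suc k)) ⟨
  binom (- 1ℚ - a) (2 ℕ.+ k) * t * s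
    ≡⟨ *-assoc (binom (- 1ℚ - a) (2 ℕ.+ k)) t s ⟩
  binom (- 1ℚ - a) (2 ℕ.+ k) * (t * s) ∎)
  where
  open ≡-Reasoning
  open +-*-Solver
  s t b b′ q : ℚ
  s = ι (1 ℕ.+ k)
  t = ι (2 ℕ.+ k)
  b = binom (- 1ℚ - a) k
  b′ = binom (- 1ℚ - a) (suc k)
  q = b ÷₀ (t * s)
  ts≢0 : t * s ≢ 0ℚ
  ts≢0 eq = ι≢0 (2 ℕ.+ k) (*-cancelʳ-≢0 t 0ℚ s (ι≢0 (1 ℕ.+ k)) (trans eq (sym (*-zeroˡ s))))

{-# OPTIONS --safe #-}

-- Write t k = term a k.  Both sums over a + k and a + k - 1, and the sum over
-- k + 1, telescope against S n a and S n (a + 1): by Gosper's algorithm, for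
-- every m,
--   2a³ ∑[k≤m] t k / (a + k) - a² S(a) - (a+1)² S(a+1)
--     = - (2a + 1) (2m + 1) t m,
--   2a²(a-1)³ ∑[k≤m] t k / (a + k - 1) - a²((a-1)² + 1) S(a) - (a²-1)² S(a+1)
--     = (2m + 1) ((4a² - 2a³ - 1) t m - 2a³ t m / (a + m)),
--   a(a+1) S(a) + (a+1)² S(a+1) - a(a+1) ∑[k<m] t k / (k + 1)
--     = (a + 1) (2a + 2m + 1) t m,
-- where S(x) = S (m + 1) x.  For m = p - 1 the right-hand sides are divisible
-- by p³: each of binom a m, binom (-1 - a) m and central m is divisible by p,
-- the first because a ≢ -1, the second because a ≢ 0; and a + m is a unit
-- because a ≢ 1.
module Submission where

open import Defs
open import Algebra.Bundles using (CommutativeRing)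
import Algebra.Properties.Semiring.Exp as Exp
open import Data.Integer.Base as ℤ using (ℤ; -[1+_]) renaming (+_ to pos)
import Data.Integer.Divisibility.Signed as ℤ
import Data.Integer.DivMod as ℤ
import Data.Integer.Properties as ℤ
import Data.Integer.Solver as ℤ
open import Data.Nat.Base as ℕ using (ℕ; zero; suc; _∸_; _!)
open import Data.Nat.Combinatorics using (_C_; nCk≡n!/k![n-k]!; k![n∸k]!∣n!)
open import Data.Nat.Coprimality as Coprimality using (Coprime)
open import Data.Nat.Divisibility as ℕ using (_∣_; _∤_)
open import Data.Nat.DivMod using (m/n*n≡m)
open import Data.Nat.GCD using (module Bézout)
open import Data.Nat.Primality
  using (Prime; prime[2]; prime⇒irreducible; prime⇒nonZero; prime⇒nonTrivial; euclidsLemma)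
import Data.Nat.Properties as ℕ
import Data.Nat.Solver as ℕ
open import Data.Product.Base using (∃; _×_; _,_; proj₁; proj₂)
open import Data.Rational.Base
  using (ℚ; mkℚ; 0ℚ; 1ℚ; _+_; _-_; _*_; -_; _/_; ≢-nonZero; ↥_; ↧_; ↧ₙ_; toℚᵘ)
open import Data.Rational.Properties
open import Data.Rational.Solver using (module +-*-Solver)
import Data.Rational.Unnormalised.Base as ℚᵘ
import Data.Rational.Unnormalised.Properties as ℚᵘ
open import Data.Sum.Base using (inj₁; inj₂; [_,_]′)
open import Relation.Binary.PropositionalEquality
open import Relation.Nullary.Decidable using (yes; no)
open import Relation.Nullary.Negation using (¬_; contradiction)

open Exp (CommutativeRing.semiring +-*-commutativeRing) using (^-homo-*)
open ≡-Reasoning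
open +-*-Solver

-- Recurrences for the terms

÷-or-*-cancel : ∀ x y v → y ≢ 0ℚ → (x ÷ y or v) * y ≡ x
÷-or-*-cancel x y v y≢0 with y ≟ 0ℚ
... | yes y≡0 = contradiction y≡0 y≢0
... | no  ¬p  = trans (*-assoc x _ y)
  (trans (cong (x *_) (*-inverseˡ y {{≢-nonZero ¬p}})) (*-identityʳ x))

-- When y vanishes the fallback v is returned by definition, and otherwise the quotient is unique.
-- This makes the cancelled forms of the terms usable without deciding whether the divisor is zero.
÷-or-quotient : ∀ x y v → v * y ≡ x → x ÷ y or v ≡ v
÷-or-quotient x y v vy≡x with y ≟ 0ℚ
... | yes _   = refl
... | no  y≢0 = *-cancelʳ-≢0 _ v y y≢0 (trans (*-assoc x _ y)
  (trans (cong (x *_) (*-inverseˡ y {{≢-nonZero y≢0}})) (trans (*-identityʳ x) (sym vy≡x))))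

*-≢0 : ∀ {x y} → x ≢ 0ℚ → y ≢ 0ℚ → x * y ≢ 0ℚ
*-≢0 {x} {y} x≢0 y≢0 xy≡0 = x≢0 (*-cancelʳ-≢0 x 0ℚ y y≢0 (trans xy≡0 (sym (*-zeroˡ y))))

^-≢0 : ∀ {x} k → x ≢ 0ℚ → x ^ k ≢ 0ℚ
^-≢0 zero    x≢0 = λ ()
^-≢0 (suc k) x≢0 = *-≢0 x≢0 (^-≢0 k x≢0)

C-central-! : ∀ k → ((2 ℕ.* k) C k) ℕ.* (k ! ℕ.* k !) ≡ (2 ℕ.* k) !
C-central-! k = trans (cong (λ i → (2k C k) ℕ.* (k ! ℕ.* i !)) (sym 2k∸k≡k))
  (trans (cong (ℕ._* (k ! ℕ.* (2k ∸ k) !)) (nCk≡n!/k![n-k]! k≤2k)) (m/n*n≡m (k![n∸k]!∣n! k≤2k)))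
  where
  2k = 2 ℕ.* k
  k≤2k = ℕ.m≤m+n k (k ℕ.+ 0)
  2k∸k≡k : 2k ∸ k ≡ k
  2k∸k≡k = trans (ℕ.m+n∸m≡n k (k ℕ.+ 0)) (ℕ.+-identityʳ k)
  instance _ = ℕ._!*_!≢0 k (2k ∸ k)

-- After multiplication by (k + 1) k!² both sides equal (2k + 2)!, by `C-central-!` at k + 1 on the
-- left and at k on the right.
C-central-suc : ∀ k → ((2 ℕ.* suc k) C suc k) ℕ.* suc k ≡ 2 ℕ.* ((1 ℕ.+ 2 ℕ.* k) ℕ.* ((2 ℕ.* k) C k))
C-central-suc k = ℕ.*-cancelʳ-≡ _ _ (suc k ℕ.* (k ! ℕ.* k !)) (begin
  c′ ℕ.* suc k ℕ.* (suc k ℕ.* (k ! ℕ.* k !))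
    ≡⟨ ℕS.solve 3 (λ c s f → c ℕS.:* s ℕS.:* (s ℕS.:* (f ℕS.:* f)) ℕS.:= c ℕS.:* ((s ℕS.:* f) ℕS.:* (s ℕS.:* f))) refl c′ (suc k) (k !) ⟩
  c′ ℕ.* (suc k ! ℕ.* suc k !)
    ≡⟨ C-central-! (suc k) ⟩
  (2 ℕ.* suc k) !
    ≡⟨ cong _! (ℕ.*-suc 2 k) ⟩
  (2 ℕ.+ 2k) ℕ.* ((1 ℕ.+ 2k) ℕ.* 2k !)
    ≡⟨ cong₂ (λ u v → u ℕ.* ((1 ℕ.+ 2k) ℕ.* v)) (ℕ.*-suc 2 k) (C-central-! k) ⟨
  2 ℕ.* suc k ℕ.* ((1 ℕ.+ 2k) ℕ.* (c ℕ.* (k ! ℕ.* k !)))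
    ≡⟨ ℕS.solve 4 (λ s d c f → ℕS.con 2 ℕS.:* s ℕS.:* (d ℕS.:* (c ℕS.:* f)) ℕS.:= ℕS.con 2 ℕS.:* (d ℕS.:* c) ℕS.:* (s ℕS.:* f)) refl (suc k) (1 ℕ.+ 2k) c (k ! ℕ.* k !) ⟩
  2 ℕ.* ((1 ℕ.+ 2k) ℕ.* c) ℕ.* (suc k ℕ.* (k ! ℕ.* k !)) ∎)
  where
  module ℕS = ℕ.+-*-Solver
  2k = 2 ℕ.* k
  c = 2k C k
  c′ = (2 ℕ.* suc k) C suc k
  instance
    _ = ℕ._!*_!≢0 k k
    _ = ℕ.m*n≢0 (suc k) (k ! ℕ.* k !)

4^≢0 : ∀ k → ι 4 ^ k ≢ 0ℚ
4^≢0 k = ^-≢0 k (ι≢0 4)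

-- This is `C-central-suc` divided by powers of 4: of the new factor 4 in the denominator, one 2
-- cancels the 2 of the binomial recurrence and the other stays on the left.
central-suc : ∀ k → central (suc k) * (ι 2 * ι (suc k)) ≡ central k * (ι 2 * ι k + 1ℚ)
central-suc k = *-cancelʳ-≢0 _ _ (ι 4 ^ suc k) (4^≢0 (suc k)) (begin
  central (suc k) * (ι 2 * s) * ι 4 ^ suc k
    ≡⟨ solve 4 (λ x t s f →
         x :* (t :* s) :* f := x :* f :* s :* t)
       refl (central (suc k)) (ι 2) s (ι 4 ^ suc k) ⟩
  central (suc k) * ι 4 ^ suc k * s * ι 2
    ≡⟨ cong (λ u → u * s * ι 2) (÷₀-*-cancel (ι c′) _ (4^≢0 (suc k))) ⟩
  ι c′ * s * ι 2
    ≡⟨ cong (_* ι 2) (ι-* c′ (suc k)) ⟨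
  ι (c′ ℕ.* suc k) * ι 2
    ≡⟨ cong (λ i → ι i * ι 2) (C-central-suc k) ⟩
  ι (2 ℕ.* ((1 ℕ.+ 2 ℕ.* k) ℕ.* c)) * ι 2
    ≡⟨ cong (_* ι 2) (trans (ι-* 2 ((1 ℕ.+ 2 ℕ.* k) ℕ.* c)) (cong (ι 2 *_) (ι-* (1 ℕ.+ 2 ℕ.* k) c))) ⟩
  ι 2 * (ι (1 ℕ.+ 2 ℕ.* k) * ι c) * ι 2
    ≡⟨ cong₂ (λ u v → ι 2 * (u * v) * ι 2)
         (trans (ι-suc (2 ℕ.* k)) (cong (λ u → 1ℚ + u) (ι-* 2 k)))
         (sym (÷₀-*-cancel (ι c) _ (4^≢0 k))) ⟩
  ι 2 * ((1ℚ + ι 2 * ι k) * (central k * ι 4 ^ k)) * ι 2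
    ≡⟨ solve 3 (λ j x f → con (ι 2) :* ((con 1ℚ :+ con (ι 2) :* j) :* (x :* f)) :* con (ι 2)
                 := x :* (con (ι 2) :* j :+ con 1ℚ) :* (con (ι 4) :* f)) refl (ι k) (central k) (ι 4 ^ k) ⟩
  central k * (ι 2 * ι k + 1ℚ) * ι 4 ^ suc k ∎)
  where
  s = ι (suc k)
  c = (2 ℕ.* k) C k
  c′ = (2 ℕ.* suc k) C suc k

-- A common denominator of the ratios of consecutive terms.
scale : ℕ → ℚ
scale k = ι 2 * (ι (suc k) * ι (suc k) * ι (suc k))

scale≢0 : ∀ k → scale k ≢ 0ℚ
scale≢0 k = *-≢0 (ι≢0 2) (*-≢0 (*-≢0 (ι≢0 (suc k)) (ι≢0 (suc k))) (ι≢0 (suc k)))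

-- Binomials with shifted argument and ratios of consecutive terms

binom-suc-+1 : ∀ x k → binom (x + 1ℚ) (suc k) * ι (suc k) ≡ (x + 1ℚ) * binom x k
binom-suc-+1 x zero = solve 1 (λ x → con 1ℚ :* ((x :+ con 1ℚ) :- con 0ℚ) :* con 1ℚ :* con 1ℚ := (x :+ con 1ℚ) :* con 1ℚ) refl x
binom-suc-+1 x (suc k) = *-cancelʳ-≢0 _ _ s (ι≢0 (suc k)) (begin
  binom (x + 1ℚ) (2 ℕ.+ k) * ι (2 ℕ.+ k) * s
    ≡⟨ cong (_* s) (binom-suc (x + 1ℚ) (suc k)) ⟩
  binom (x + 1ℚ) (suc k) * (x + 1ℚ - s) * s
    ≡⟨ solve 3 (λ b y s → b :* y :* s := b :* s :* y) refl (binom (x + 1ℚ) (suc k)) (x + 1ℚ - s) s ⟩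
  binom (x + 1ℚ) (suc k) * s * (x + 1ℚ - s)
    ≡⟨ cong₂ (λ u v → u * (x + 1ℚ - v)) (binom-suc-+1 x k) (ι-suc k) ⟩
  (x + 1ℚ) * binom x k * (x + 1ℚ - (1ℚ + ι k))
    ≡⟨ solve 3 (λ x b i →
         (x :+ con 1ℚ) :* b :* (x :+ con 1ℚ :- (con 1ℚ :+ i)) := (x :+ con 1ℚ) :* (b :* (x :- i)))
       refl x (binom x k) (ι k) ⟩
  (x + 1ℚ) * (binom x k * (x - ι k))
    ≡⟨ cong ((x + 1ℚ) *_) (binom-suc x k) ⟨
  (x + 1ℚ) * (binom x (suc k) * s)
    ≡⟨ *-assoc (x + 1ℚ) _ s ⟨
  (x + 1ℚ) * binom x (suc k) * s ∎)
  where s = ι (suc k)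

binom-+1 : ∀ x k → binom (x + 1ℚ) k * (x + 1ℚ - ι k) ≡ (x + 1ℚ) * binom x k
binom-+1 x k = trans (sym (binom-suc (x + 1ℚ) k)) (binom-suc-+1 x k)

-- Put x = -1 - (a + 1). Then x + 1 = -1 - a = -(a + 1) and x + 1 - k = -(a + 1 + k), so this is
-- `binom-+1` at x with both signs changed.
binom-neg-+1 : ∀ a k → binom (- 1ℚ - (a + 1ℚ)) k * (a + 1ℚ) ≡ binom (- 1ℚ - a) k * (a + 1ℚ + ι k)
binom-neg-+1 a k = begin
  b * (a + 1ℚ)
    ≡⟨ solve 2 (λ a b → b :* (a :+ con 1ℚ) := :- ((con (- 1ℚ) :- (a :+ con 1ℚ) :+ con 1ℚ) :* b)) refl a b ⟩
  - ((x + 1ℚ) * b)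
    ≡⟨ cong -_ (binom-+1 x k) ⟨
  - (binom (x + 1ℚ) k * (x + 1ℚ - ι k))
    ≡⟨ cong (λ y → - (binom y k * (x + 1ℚ - ι k))) (solve 1 (λ a → con (- 1ℚ) :- (a :+ con 1ℚ) :+ con 1ℚ := con (- 1ℚ) :- a) refl a) ⟩
  - (b′ * (x + 1ℚ - ι k))
    ≡⟨ solve 3 (λ a b j →
         :- (b :* (con (- 1ℚ) :- (a :+ con 1ℚ) :+ con 1ℚ :- j)) := b :* (a :+ con 1ℚ :+ j))
       refl a b′ (ι k) ⟩
  b′ * (a + 1ℚ + ι k) ∎
  where
  x = - 1ℚ - (a + 1ℚ)
  b = binom x k
  b′ = binom (- 1ℚ - a) k

-- Each of the two binomials uses up one factor k + 1 of `scale k`, and `central` uses up 2 (k + 1).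
-- The sign comes from -1 - a - k = -(a + 1 + k).
term-suc : ∀ a k → term a (suc k) * scale k
         ≡ - (term a k * ((a - ι k) * (a + (1ℚ + ι k)) * (ι 2 * ι k + 1ℚ)))
term-suc a k = begin
  x′ * y′ * c′ * scale k
    ≡⟨ solve 5 (λ x y c d s →
         x :* y :* c :* (d :* (s :* s :* s)) := (x :* s) :* (y :* s) :* (c :* (d :* s)))
       refl x′ y′ c′ (ι 2) s ⟩
  (x′ * s) * (y′ * s) * (c′ * (ι 2 * s))
    ≡⟨ cong₂ _*_ (cong₂ _*_ (binom-suc a k) (binom-suc (- 1ℚ - a) k)) (central-suc k) ⟩
  (x * (a - j)) * (y * (- 1ℚ - a - j)) * (c * d)
    ≡⟨ solve 6 (λ a j x y c d → (x :* (a :- j)) :* (y :* (con (- 1ℚ) :- a :- j)) :* (c :* d)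
                 := :- (x :* y :* c :* ((a :- j) :* (a :+ (con 1ℚ :+ j)) :* d))) refl a j x y c d ⟩
  - (term a k * ((a - j) * (a + (1ℚ + j)) * d)) ∎
  where
  s = ι (suc k)
  j = ι k
  x = binom a k
  y = binom (- 1ℚ - a) k
  c = central k
  d = ι 2 * ι k + 1ℚ
  x′ = binom a (suc k)
  y′ = binom (- 1ℚ - a) (suc k)
  c′ = central (suc k)

-- Relates the shifted argument to the unshifted term of the previous index, so that the increments
-- of S(a) and S(a + 1) are both multiples of `term a k`. The factor a + 1 that absorption takes out
-- of the first binomial is consumed by the second through `binom-neg-+1`.
term-+1-suc : ∀ a k → term (a + 1ℚ) (suc k) * scale k
            ≡ - (term a k * ((a + (1ℚ + ι k)) * (a + 1ℚ + (1ℚ + ι k)) * (ι 2 * ι k + 1ℚ)))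
term-+1-suc a k = begin
  x′ * z′ * c′ * scale k
    ≡⟨ solve 5 (λ x z c d s →
         x :* z :* c :* (d :* (s :* s :* s)) := (x :* s) :* z :* (c :* (d :* s)) :* s)
       refl x′ z′ c′ (ι 2) s ⟩
  (x′ * s) * z′ * (c′ * (ι 2 * s)) * s
    ≡⟨ cong₂ (λ u v → u * z′ * v * s) (binom-suc-+1 a k) (central-suc k) ⟩
  (a + 1ℚ) * x * z′ * (c * d) * s
    ≡⟨ solve 6 (λ a x z c d s →
         (a :+ con 1ℚ) :* x :* z :* (c :* d) :* s := (z :* (a :+ con 1ℚ)) :* (x :* (c :* d)) :* s)
       refl a x z′ c d s ⟩
  (z′ * (a + 1ℚ)) * (x * (c * d)) * s
    ≡⟨ cong (λ u → u * (x * (c * d)) * s) (binom-neg-+1 a (suc k)) ⟩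
  y′ * (a + 1ℚ + s) * (x * (c * d)) * s
    ≡⟨ solve 6 (λ a y x c d s →
         y :* (a :+ con 1ℚ :+ s) :* (x :* (c :* d)) :* s
         := (y :* s) :* (a :+ con 1ℚ :+ s) :* (x :* (c :* d)))
       refl a y′ x c d s ⟩
  (y′ * s) * (a + 1ℚ + s) * (x * (c * d))
    ≡⟨ cong₂ (λ u v → u * (a + 1ℚ + v) * (x * (c * d))) (binom-suc (- 1ℚ - a) k) (ι-suc k) ⟩
  (y * (- 1ℚ - a - j)) * (a + 1ℚ + (1ℚ + j)) * (x * (c * d))
    ≡⟨ solve 6 (λ a j x y c d → (y :* (con (- 1ℚ) :- a :- j)) :* (a :+ con 1ℚ :+ (con 1ℚ :+ j)) :* (x :* (c :* d))
                 := :- (x :* y :* c :* ((a :+ (con 1ℚ :+ j)) :* (a :+ con 1ℚ :+ (con 1ℚ :+ j)) :* d))) refl a j x y c d ⟩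
  - (term a k * ((a + (1ℚ + j)) * (a + 1ℚ + (1ℚ + j)) * d)) ∎
  where
  s = ι (suc k)
  j = ι k
  x = binom a k
  y = binom (- 1ℚ - a) k
  c = central k
  d = ι 2 * ι k + 1ℚ
  x′ = binom (a + 1ℚ) (suc k)
  z′ = binom (- 1ℚ - (a + 1ℚ)) (suc k)
  y′ = binom (- 1ℚ - a) (suc k)
  c′ = central (suc k)

-- Terms with a cancelled factor

*-cancelled : ∀ x {y z} c {d} → y * d ≡ z → x * y * c * d ≡ x * z * c
*-cancelled x {y} c {d} refl = solve 4 (λ x y c d → x :* y :* c :* d := x :* (y :* d) :* c) refl x y c d

term/₀-suc : ∀ a k → term/₀ a (suc k) ≡ binom a (suc k) * binom/₀ a (suc k) * central (suc k)
term/₀-suc a k = ÷-or-quotient _ _ _ (*-cancelled (binom a (suc k)) (central (suc k)) (binom/₀-correct a k))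

-- For k = 0 the divisor is a itself, so this is true division. For k ≥ 1 the cancelled form
-- supplies the equation, also at a vanishing divisor.
term/₀-* : ∀ a k → a ≢ 0ℚ → term/₀ a k * (a + ι k) ≡ term a k
term/₀-* a zero    a≢0 = ÷-or-*-cancel _ _ _ (λ eq → a≢0 (trans (sym (+-identityʳ a)) eq))
term/₀-* a (suc k) a≢0 = trans (cong (_* (a + ι (suc k))) (term/₀-suc a k))
  (*-cancelled (binom a (suc k)) (central (suc k)) (binom/₀-correct a k))

-- The recurrence `term-suc` with the factor a + k + 1 removed: `binom/₀` at k + 1 is the previous
-- binomial over -(k + 1), which is where that factor would have entered.
term/₀-suc-scale : ∀ a k → term/₀ a (suc k) * scale k
                 ≡ - (term a k * ((a - ι k) * (ι 2 * ι k + 1ℚ)))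
term/₀-suc-scale a k = begin
  term/₀ a (suc k) * scale k
    ≡⟨ cong (_* scale k) (term/₀-suc a k) ⟩
  x′ * (- q) * c′ * (ι 2 * (s * s * s))
    ≡⟨ solve 5 (λ x q c d s →
         x :* (:- q) :* c :* (d :* (s :* s :* s)) := :- ((x :* s) :* (q :* s) :* (c :* (d :* s))))
       refl x′ q c′ (ι 2) s ⟩
  - ((x′ * s) * (q * s) * (c′ * (ι 2 * s)))
    ≡⟨ cong -_ (cong₂ _*_ (cong₂ _*_ (binom-suc a k) (÷₀-*-cancel y s (ι≢0 (suc k)))) (central-suc k)) ⟩
  - ((x * (a - j)) * y * (c * d))
    ≡⟨ solve 5 (λ x e y c d →
         :- ((x :* e) :* y :* (c :* d)) := :- (x :* y :* c :* (e :* d)))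
       refl x (a - j) y c d ⟩
  - (term a k * ((a - j) * d)) ∎
  where
  s = ι (suc k)
  j = ι k
  x = binom a k
  y = binom (- 1ℚ - a) k
  q = y ÷₀ s
  c = central k
  d = ι 2 * ι k + 1ℚ
  x′ = binom a (suc k)
  c′ = central (suc k)

-- In both cancelled binomials the missing factor is a + k + 1, since (k + 2) - 1 = k + 1. Hence
-- they differ only by the last factor a + k + 2, the denominator k + 2 and a sign.
binom/₁-binom/₀ : ∀ a k → binom/₁ a (2 ℕ.+ k) * ι (2 ℕ.+ k) ≡ - ((a + ι (2 ℕ.+ k)) * binom/₀ a (suc k))
binom/₁-binom/₀ a k = begin
  (a + s) * q * s      ≡⟨ solve 3 (λ a s q →
      (a :+ s) :* q :* s := :- ((a :+ s) :* (:- (q :* s))))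
    refl a s q ⟩
  - ((a + s) * - (q * s)) ≡⟨ cong (λ u → - ((a + s) * - u)) qs≡ ⟩
  - ((a + s) * - (y ÷₀ r)) ∎
  where
  r = ι (1 ℕ.+ k)
  s = ι (2 ℕ.+ k)
  y = binom (- 1ℚ - a) k
  q = y ÷₀ (s * r)
  qs≡ : q * s ≡ y ÷₀ r
  qs≡ = *-cancelʳ-≢0 _ _ r (ι≢0 (suc k)) (begin
    q * s * r    ≡⟨ *-assoc q s r ⟩
    q * (s * r)  ≡⟨ ÷₀-*-cancel y _ (*-≢0 (ι≢0 (2 ℕ.+ k)) (ι≢0 (1 ℕ.+ k))) ⟩
    y            ≡⟨ ÷₀-*-cancel y r (ι≢0 (1 ℕ.+ k)) ⟨
    y ÷₀ r * r   ∎)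

term/₁-2+ : ∀ a k → term/₁ a (2 ℕ.+ k) ≡ binom a (2 ℕ.+ k) * binom/₁ a (2 ℕ.+ k) * central (2 ℕ.+ k)
term/₁-2+ a k = ÷-or-quotient _ _ _
  (*-cancelled (binom a (2 ℕ.+ k)) (central (2 ℕ.+ k)) (binom/₁-correct a k))

-- The divisor a + (k + 1) - 1 of `term/₁` at k + 1 is the divisor a + k of `term/₀` at k, so this
-- is `term-suc` with both sides divided by a + k.
term/₁-suc-scale : ∀ a k → a ≢ 0ℚ → term/₁ a (suc k) * scale k
                 ≡ - (term/₀ a k * ((a - ι k) * (a + (1ℚ + ι k)) * (ι 2 * ι k + 1ℚ)))
-- `binom/₁` has no meaningful value at index 1. There the divisor is a + 1 - 1 = a, which is
-- nonzero, so both quotients are genuine and multiplying by a reduces the claim to `term-suc`.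
term/₁-suc-scale a zero a≢0 = *-cancelʳ-≢0 _ _ a a≢0 (begin
  u * scale 0 * a
    ≡⟨ solve 3 (λ a u e → u :* e :* a := u :* (a :+ con (ι 1) :- con 1ℚ) :* e) refl a u (scale 0) ⟩
  u * (a + ι 1 - 1ℚ) * scale 0
    ≡⟨ cong (_* scale 0) (÷-or-*-cancel (term a 1) (a + ι 1 - 1ℚ) (binom a 1 * binom/₁ a 1 * central 1) (λ eq → a≢0 (trans a≡ eq))) ⟩
  term a 1 * scale 0
    ≡⟨ term-suc a 0 ⟩
  - (term a 0 * f)
    ≡⟨ cong (λ t → - (t * f)) (term/₀-* a 0 a≢0) ⟨
  - (v * (a + ι 0) * f)
    ≡⟨ solve 3 (λ a v f → :- (v :* (a :+ con (ι 0)) :* f) := (:- (v :* f)) :* a) refl a v f ⟩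
  - (v * f) * a ∎)
  where
  u = term/₁ a 1
  v = term/₀ a 0
  f = (a - ι 0) * (a + (1ℚ + ι 0)) * (ι 2 * ι 0 + 1ℚ)
  a≡ : a ≡ a + ι 1 - 1ℚ
  a≡ = solve 1 (λ a → a := a :+ con (ι 1) :- con 1ℚ) refl a
term/₁-suc-scale a (suc k) _ = begin
  term/₁ a (2 ℕ.+ k) * scale (suc k)
    ≡⟨ cong (_* scale (suc k)) (term/₁-2+ a k) ⟩
  x′ * y′ * c′ * (ι 2 * (s * s * s))
    ≡⟨ solve 5 (λ x y c d s →
         x :* y :* c :* (d :* (s :* s :* s)) := (x :* s) :* (y :* s) :* (c :* (d :* s)))
       refl x′ y′ c′ (ι 2) s ⟩
  (x′ * s) * (y′ * s) * (c′ * (ι 2 * s))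
    ≡⟨ cong₂ _*_ (cong₂ _*_ (binom-suc a (suc k)) (binom/₁-binom/₀ a k)) (central-suc (suc k)) ⟩
  (x * (a - j)) * (- ((a + s) * y)) * (c * d)
    ≡⟨ solve 6 (λ x e f y c d →
         (x :* e) :* (:- (f :* y)) :* (c :* d) := :- (x :* y :* c :* (e :* f :* d)))
       refl x (a - j) (a + s) y c d ⟩
  - (x * y * c * ((a - j) * (a + s) * d))
    ≡⟨ cong₂ (λ u v → - (u * ((a - j) * (a + v) * d))) (sym (term/₀-suc a k)) (ι-suc (suc k)) ⟩
  - (term/₀ a (suc k) * ((a - j) * (a + (1ℚ + j)) * d)) ∎
  where
  j = ι (suc k)
  s = ι (2 ℕ.+ k)
  x = binom a (suc k)
  y = binom/₀ a (suc k)
  c = central (suc k)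
  d = ι 2 * j + 1ℚ
  x′ = binom a (2 ℕ.+ k)
  y′ = binom/₁ a (2 ℕ.+ k)
  c′ = central (2 ℕ.+ k)

-- Telescoping sums

scale-ι : ∀ k → scale k ≡ ι 2 * ((1ℚ + ι k) * (1ℚ + ι k) * (1ℚ + ι k))
scale-ι k = cong (λ s → ι 2 * (s * s * s)) (ι-suc k)

-- Induction on m. After multiplication by `scale m`, each summand added at m + 1 is a polynomial
-- multiple of `term a m`, so the step becomes a polynomial identity.
telescope₀ : ∀ a m → a ≢ 0ℚ →
  ι 2 * a ^ 3 * ∑< (suc m) (term/₀ a) - a ^ 2 * S (suc m) a - (a + 1ℚ) ^ 2 * S (suc m) (a + 1ℚ)
  ≡ - ((ι 2 * a + 1ℚ) * (ι 2 * ι m + 1ℚ) * term a m)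
telescope₀ a zero a≢0 = begin
  ι 2 * a ^ 3 * (0ℚ + v) - a ^ 2 * (0ℚ + 1ℚ) - (a + 1ℚ) ^ 2 * (0ℚ + 1ℚ)
    ≡⟨ solve 2 (λ a v → con (ι 2) :* a :^ 3 :* (con 0ℚ :+ v) :- a :^ 2 :* (con 0ℚ :+ con 1ℚ) :- (a :+ con 1ℚ) :^ 2 :* (con 0ℚ :+ con 1ℚ)
                 := con (ι 2) :* a :^ 2 :* (v :* (a :+ con (ι 0))) :- a :^ 2 :- (a :+ con 1ℚ) :^ 2) refl a v ⟩
  ι 2 * a ^ 2 * (v * (a + ι 0)) - a ^ 2 - (a + 1ℚ) ^ 2
    ≡⟨ cong (λ u → ι 2 * a ^ 2 * u - a ^ 2 - (a + 1ℚ) ^ 2) (term/₀-* a 0 a≢0) ⟩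
  ι 2 * a ^ 2 * 1ℚ - a ^ 2 - (a + 1ℚ) ^ 2
    ≡⟨ solve 1 (λ a → con (ι 2) :* a :^ 2 :* con 1ℚ :- a :^ 2 :- (a :+ con 1ℚ) :^ 2
                 := :- ((con (ι 2) :* a :+ con 1ℚ) :* (con (ι 2) :* con (ι 0) :+ con 1ℚ) :* con 1ℚ)) refl a ⟩
  - ((ι 2 * a + 1ℚ) * (ι 2 * ι 0 + 1ℚ) * 1ℚ) ∎
  where v = term/₀ a 0
telescope₀ a (suc m) a≢0 = *-cancelʳ-≢0 _ _ (scale m) (scale≢0 m) (begin
  (A * (V + v′) - B * (X + t′) - D * (Y + w′)) * N
    ≡⟨ solve 10 (λ A B D V X Y v t w N → (A :* (V :+ v) :- B :* (X :+ t) :- D :* (Y :+ w)) :* N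
                 := (A :* V :- B :* X :- D :* Y) :* N :+ (A :* (v :* N) :- B :* (t :* N) :- D :* (w :* N))) refl A B D V X Y v′ t′ w′ N ⟩
  (A * V - B * X - D * Y) * N + (A * (v′ * N) - B * (t′ * N) - D * (w′ * N))
    ≡⟨ cong₂ _+_ (cong₂ _*_ (telescope₀ a m a≢0) (scale-ι m))
         (cong₂ _-_ (cong₂ _-_ (cong (A *_) (term/₀-suc-scale a m)) (cong (B *_) (term-suc a m))) (cong (D *_) (term-+1-suc a m))) ⟩
  - ((ι 2 * a + 1ℚ) * (ι 2 * j + 1ℚ) * t) * (ι 2 * ((1ℚ + j) * (1ℚ + j) * (1ℚ + j)))
  + (A * - (t * ((a - j) * (ι 2 * j + 1ℚ)))
     - B * - (t * ((a - j) * (a + (1ℚ + j)) * (ι 2 * j + 1ℚ)))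
     - D * - (t * ((a + (1ℚ + j)) * (a + 1ℚ + (1ℚ + j)) * (ι 2 * j + 1ℚ))))
    -- The check of Gosper's certificate: the old boundary term plus the three increments is the new
    -- boundary term, with `term-suc` already substituted in it.
    ≡⟨ solve 3 (λ a j t →
         let s = con 1ℚ :+ j; d = con (ι 2) :* j :+ con 1ℚ; e = con (ι 2) :* a :+ con 1ℚ in
         :- (e :* d :* t) :* (con (ι 2) :* (s :* s :* s))
         :+ (con (ι 2) :* a :^ 3 :* (:- (t :* ((a :- j) :* d)))
            :- a :^ 2 :* (:- (t :* ((a :- j) :* (a :+ s) :* d)))
            :- (a :+ con 1ℚ) :^ 2 :* (:- (t :* ((a :+ s) :* (a :+ con 1ℚ :+ s) :* d))))
         := (:- (e :* (con (ι 2) :* s :+ con 1ℚ))) :* (:- (t :* ((a :- j) :* (a :+ s) :* d)))) refl a j t ⟩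
  - ((ι 2 * a + 1ℚ) * (ι 2 * (1ℚ + j) + 1ℚ)) * - (t * ((a - j) * (a + (1ℚ + j)) * (ι 2 * j + 1ℚ)))
    ≡⟨ cong₂ (λ s u → - ((ι 2 * a + 1ℚ) * (ι 2 * s + 1ℚ)) * u) (ι-suc m) (term-suc a m) ⟨
  - ((ι 2 * a + 1ℚ) * (ι 2 * ι (suc m) + 1ℚ)) * (t′ * N)
    ≡⟨ solve 3 (λ e t N →
         (:- e) :* (t :* N) := :- (e :* t) :* N)
       refl ((ι 2 * a + 1ℚ) * (ι 2 * ι (suc m) + 1ℚ)) t′ N ⟩
  - ((ι 2 * a + 1ℚ) * (ι 2 * ι (suc m) + 1ℚ) * t′) * N ∎)
  where
  A = ι 2 * a ^ 3
  B = a ^ 2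
  D = (a + 1ℚ) ^ 2
  V = ∑< (suc m) (term/₀ a)
  X = S (suc m) a
  Y = S (suc m) (a + 1ℚ)
  N = scale m
  j = ι m
  t = term a m
  t′ = term a (suc m)
  v′ = term/₀ a (suc m)
  w′ = term (a + 1ℚ) (suc m)

-- The same induction. The sum over k + 1 is one term shorter, so its increment is `term a m` over m
-- + 1, a denominator that `scale m` clears.
telescope-S : ∀ a m →
  a * (a + 1ℚ) * S (suc m) a + (a + 1ℚ) ^ 2 * S (suc m) (a + 1ℚ)
  - a * (a + 1ℚ) * ∑< m (λ k → term a k ÷₀ ι (suc k))
  ≡ (a + 1ℚ) * (ι 2 * (a + ι m) + 1ℚ) * term a m
telescope-S a zero = solve 1 (λ a →
  let one = con 0ℚ :+ con 1ℚ in
  a :* (a :+ con 1ℚ) :* one :+ (a :+ con 1ℚ) :^ 2 :* one :- a :* (a :+ con 1ℚ) :* con 0ℚ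
  := (a :+ con 1ℚ) :* (con (ι 2) :* (a :+ con (ι 0)) :+ con 1ℚ) :* con 1ℚ) refl a
telescope-S a (suc m) = *-cancelʳ-≢0 _ _ (scale m) (scale≢0 m) (begin
  (A * (X + t′) + D * (Y + w′) - A * (T + q)) * N
    ≡⟨ solve 9 (λ A D X Y T t w q N → (A :* (X :+ t) :+ D :* (Y :+ w) :- A :* (T :+ q)) :* N
                 := (A :* X :+ D :* Y :- A :* T) :* N :+ (A :* (t :* N) :+ D :* (w :* N) :- A :* (q :* N))) refl A D X Y T t′ w′ q N ⟩
  (A * X + D * Y - A * T) * N + (A * (t′ * N) + D * (w′ * N) - A * (q * N))
    ≡⟨ cong₂ _+_ (cong₂ _*_ (telescope-S a m) (scale-ι m))
         (cong₂ _-_ (cong₂ _+_ (cong (A *_) (term-suc a m)) (cong (D *_) (term-+1-suc a m))) (cong (A *_) q*N≡)) ⟩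
  (a + 1ℚ) * (ι 2 * (a + j) + 1ℚ) * t * (ι 2 * ((1ℚ + j) * (1ℚ + j) * (1ℚ + j)))
  + (A * - (t * ((a - j) * (a + (1ℚ + j)) * (ι 2 * j + 1ℚ)))
     + D * - (t * ((a + (1ℚ + j)) * (a + 1ℚ + (1ℚ + j)) * (ι 2 * j + 1ℚ)))
     - A * (t * (ι 2 * ((1ℚ + j) * (1ℚ + j)))))
    ≡⟨ solve 3 (λ a j t →
         let s = con 1ℚ :+ j; d = con (ι 2) :* j :+ con 1ℚ; b = a :+ con 1ℚ in
         b :* (con (ι 2) :* (a :+ j) :+ con 1ℚ) :* t :* (con (ι 2) :* (s :* s :* s))
         :+ (a :* b :* (:- (t :* ((a :- j) :* (a :+ s) :* d)))
            :+ b :^ 2 :* (:- (t :* ((a :+ s) :* (b :+ s) :* d)))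
            :- a :* b :* (t :* (con (ι 2) :* (s :* s))))
         := b :* (con (ι 2) :* (a :+ s) :+ con 1ℚ) :* (:- (t :* ((a :- j) :* (a :+ s) :* d)))) refl a j t ⟩
  (a + 1ℚ) * (ι 2 * (a + (1ℚ + j)) + 1ℚ) * - (t * ((a - j) * (a + (1ℚ + j)) * (ι 2 * j + 1ℚ)))
    ≡⟨ cong₂ (λ s u → (a + 1ℚ) * (ι 2 * (a + s) + 1ℚ) * u) (ι-suc m) (term-suc a m) ⟨
  (a + 1ℚ) * (ι 2 * (a + ι (suc m)) + 1ℚ) * (t′ * N)
    ≡⟨ *-assoc ((a + 1ℚ) * (ι 2 * (a + ι (suc m)) + 1ℚ)) t′ N ⟨
  (a + 1ℚ) * (ι 2 * (a + ι (suc m)) + 1ℚ) * t′ * N ∎)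
  where
  A = a * (a + 1ℚ)
  D = (a + 1ℚ) ^ 2
  T = ∑[ k < m ] (term a k ÷₀ ι (suc k))
  X = S (suc m) a
  Y = S (suc m) (a + 1ℚ)
  N = scale m
  j = ι m
  t = term a m
  q = t ÷₀ ι (suc m)
  t′ = term a (suc m)
  w′ = term (a + 1ℚ) (suc m)
  q*N≡ : q * N ≡ t * (ι 2 * ((1ℚ + j) * (1ℚ + j)))
  q*N≡ = begin
    q * N
      ≡⟨ solve 2 (λ q s →
           q :* (con (ι 2) :* (s :* s :* s)) := q :* s :* (con (ι 2) :* (s :* s)))
         refl q (ι (suc m)) ⟩
    q * ι (suc m) * (ι 2 * (ι (suc m) * ι (suc m)))
      ≡⟨ cong₂ (λ u s → u * (ι 2 * (s * s))) (÷₀-*-cancel t (ι (suc m)) (ι≢0 (suc m))) (ι-suc m) ⟩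
    t * (ι 2 * ((1ℚ + j) * (1ℚ + j))) ∎

telescope₁ : ∀ a m → a ≢ 0ℚ → a - 1ℚ ≢ 0ℚ →
  ι 2 * a ^ 2 * (a - 1ℚ) ^ 3 * ∑< (suc m) (term/₁ a)
  - a ^ 2 * ((a - 1ℚ) ^ 2 + 1ℚ) * S (suc m) a
  - (a + 1ℚ) ^ 2 * (a - 1ℚ) ^ 2 * S (suc m) (a + 1ℚ)
  ≡ (ι 2 * ι m + 1ℚ) * ((ι 4 * a ^ 2 - ι 2 * a ^ 3 - 1ℚ) * term a m - ι 2 * a ^ 3 * term/₀ a m)
telescope₁ a zero a≢0 a-1≢0 = begin
  ι 2 * a ^ 2 * (a - 1ℚ) ^ 3 * (0ℚ + u) - a ^ 2 * ((a - 1ℚ) ^ 2 + 1ℚ) * (0ℚ + 1ℚ) - (a + 1ℚ) ^ 2 * (a - 1ℚ) ^ 2 * (0ℚ + 1ℚ)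
    ≡⟨ solve 2 (λ a u → let b = a :- con 1ℚ; one = con 0ℚ :+ con 1ℚ in
         con (ι 2) :* a :^ 2 :* b :^ 3 :* (con 0ℚ :+ u) :- a :^ 2 :* (b :^ 2 :+ con 1ℚ) :* one :- (a :+ con 1ℚ) :^ 2 :* b :^ 2 :* one
         := con (ι 2) :* a :^ 2 :* b :^ 2 :* (u :* (a :+ con (ι 0) :- con 1ℚ)) :- (a :^ 2 :* (b :^ 2 :+ con 1ℚ) :+ (a :+ con 1ℚ) :^ 2 :* b :^ 2)) refl a u ⟩
  ι 2 * a ^ 2 * (a - 1ℚ) ^ 2 * (u * (a + ι 0 - 1ℚ)) - r
    ≡⟨ cong (λ x → ι 2 * a ^ 2 * (a - 1ℚ) ^ 2 * x - r) (÷-or-*-cancel (term a 0) (a + ι 0 - 1ℚ) _ (λ eq → a-1≢0 (trans a-1≡ eq))) ⟩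
  ι 2 * a ^ 2 * (a - 1ℚ) ^ 2 * 1ℚ - r
    ≡⟨ solve 1 (λ a → let b = a :- con 1ℚ in
         con (ι 2) :* a :^ 2 :* b :^ 2 :* con 1ℚ :- (a :^ 2 :* (b :^ 2 :+ con 1ℚ) :+ (a :+ con 1ℚ) :^ 2 :* b :^ 2)
         := (con (ι 2) :* con (ι 0) :+ con 1ℚ) :* ((con (ι 4) :* a :^ 2 :- con (ι 2) :* a :^ 3 :- con 1ℚ) :* con 1ℚ :- con (ι 2) :* a :^ 2 :* con 1ℚ)) refl a ⟩
  (ι 2 * ι 0 + 1ℚ) * (e * 1ℚ - ι 2 * a ^ 2 * 1ℚ)
    ≡⟨ cong (λ x → (ι 2 * ι 0 + 1ℚ) * (e * 1ℚ - ι 2 * a ^ 2 * x)) (term/₀-* a 0 a≢0) ⟨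
  (ι 2 * ι 0 + 1ℚ) * (e * 1ℚ - ι 2 * a ^ 2 * (v * (a + ι 0)))
    ≡⟨ cong (λ x → (ι 2 * ι 0 + 1ℚ) * (e * 1ℚ - x)) (solve 2 (λ a v → con (ι 2) :* a :^ 2 :* (v :* (a :+ con (ι 0))) := con (ι 2) :* a :^ 3 :* v) refl a v) ⟩
  (ι 2 * ι 0 + 1ℚ) * (e * 1ℚ - ι 2 * a ^ 3 * v) ∎
  where
  u = term/₁ a 0
  v = term/₀ a 0
  e = ι 4 * a ^ 2 - ι 2 * a ^ 3 - 1ℚ
  r = a ^ 2 * ((a - 1ℚ) ^ 2 + 1ℚ) + (a + 1ℚ) ^ 2 * (a - 1ℚ) ^ 2
  a-1≡ : a - 1ℚ ≡ a + ι 0 - 1ℚ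
  a-1≡ = cong (_- 1ℚ) (sym (+-identityʳ a))
telescope₁ a (suc m) a≢0 a-1≢0 = *-cancelʳ-≢0 _ _ (scale m) (scale≢0 m) (begin
  (A * (U + u′) - B * (X + t′) - D * (Y + w′)) * N
    ≡⟨ solve 10 (λ A B D V X Y v t w N → (A :* (V :+ v) :- B :* (X :+ t) :- D :* (Y :+ w)) :* N
                 := (A :* V :- B :* X :- D :* Y) :* N :+ (A :* (v :* N) :- B :* (t :* N) :- D :* (w :* N))) refl A B D U X Y u′ t′ w′ N ⟩
  (A * U - B * X - D * Y) * N + (A * (u′ * N) - B * (t′ * N) - D * (w′ * N))
    ≡⟨ cong₂ _+_ (cong₂ _*_ (telescope₁ a m a≢0 a-1≢0) (scale-ι m))
         (cong₂ _-_ (cong₂ _-_ (cong (A *_) (term/₁-suc-scale a m a≢0)) (cong (B *_) (term-suc a m))) (cong (D *_) (term-+1-suc a m))) ⟩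
  lhs t
    -- The boundary term involves both `term a m` and `term/₀ a m`. Writing the former as a + m
    -- times the latter leaves a single unknown v and a polynomial identity.
    ≡⟨ cong lhs (term/₀-* a m a≢0) ⟨
  lhs (v * (a + j))
    ≡⟨ solve 3 (λ a j v →
         let s = con 1ℚ :+ j; d = con (ι 2) :* j :+ con 1ℚ; b = a :- con 1ℚ; t = v :* (a :+ j)
             e = con (ι 4) :* a :^ 2 :- con (ι 2) :* a :^ 3 :- con 1ℚ in
         d :* (e :* t :- con (ι 2) :* a :^ 3 :* v) :* (con (ι 2) :* (s :* s :* s))
         :+ (con (ι 2) :* a :^ 2 :* b :^ 3 :* (:- (v :* ((a :- j) :* (a :+ s) :* d)))
            :- a :^ 2 :* (b :^ 2 :+ con 1ℚ) :* (:- (t :* ((a :- j) :* (a :+ s) :* d)))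
            :- (a :+ con 1ℚ) :^ 2 :* b :^ 2 :* (:- (t :* ((a :+ s) :* (a :+ con 1ℚ :+ s) :* d))))
         := (con (ι 2) :* s :+ con 1ℚ) :* (e :* (:- (t :* ((a :- j) :* (a :+ s) :* d))) :- con (ι 2) :* a :^ 3 :* (:- (t :* ((a :- j) :* d))))) refl a j v ⟩
  rhs (v * (a + j))
    ≡⟨ cong rhs (term/₀-* a m a≢0) ⟩
  rhs t
    ≡⟨ cong₂ _*_ (cong (λ s → ι 2 * s + 1ℚ) (ι-suc m)) (cong₂ (λ x y → e * x - ι 2 * a ^ 3 * y) (term-suc a m) (term/₀-suc-scale a m)) ⟨
  (ι 2 * ι (suc m) + 1ℚ) * (e * (t′ * N) - ι 2 * a ^ 3 * (v′ * N))
    ≡⟨ solve 6 (λ d e t f v N →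
         d :* (e :* (t :* N) :- f :* (v :* N)) := d :* (e :* t :- f :* v) :* N)
       refl (ι 2 * ι (suc m) + 1ℚ) e t′ (ι 2 * a ^ 3) v′ N ⟩
  (ι 2 * ι (suc m) + 1ℚ) * (e * t′ - ι 2 * a ^ 3 * v′) * N ∎)
  where
  A = ι 2 * a ^ 2 * (a - 1ℚ) ^ 3
  B = a ^ 2 * ((a - 1ℚ) ^ 2 + 1ℚ)
  D = (a + 1ℚ) ^ 2 * (a - 1ℚ) ^ 2
  U = ∑< (suc m) (term/₁ a)
  X = S (suc m) a
  Y = S (suc m) (a + 1ℚ)
  N = scale m
  j = ι m
  t = term a m
  v = term/₀ a m
  t′ = term a (suc m)
  v′ = term/₀ a (suc m)
  u′ = term/₁ a (suc m)
  w′ = term (a + 1ℚ) (suc m)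
  e = ι 4 * a ^ 2 - ι 2 * a ^ 3 - 1ℚ
  lhs rhs : ℚ → ℚ
  lhs t =
    (ι 2 * j + 1ℚ) * (e * t - ι 2 * a ^ 3 * v) * (ι 2 * ((1ℚ + j) * (1ℚ + j) * (1ℚ + j)))
    + (A * - (v * ((a - j) * (a + (1ℚ + j)) * (ι 2 * j + 1ℚ)))
       - B * - (t * ((a - j) * (a + (1ℚ + j)) * (ι 2 * j + 1ℚ)))
       - D * - (t * ((a + (1ℚ + j)) * (a + 1ℚ + (1ℚ + j)) * (ι 2 * j + 1ℚ))))
  rhs t =
    (ι 2 * (1ℚ + j) + 1ℚ) * (e * - (t * ((a - j) * (a + (1ℚ + j)) * (ι 2 * j + 1ℚ))) - ι 2 * a ^ 3 * - (t * ((a - j) * (ι 2 * j + 1ℚ))))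

-- The localization of ℤ at p

toℚᵘ-/1 : ∀ n → toℚᵘ (n / 1) ℚᵘ.≃ ℚᵘ.mkℚᵘ n 0
toℚᵘ-/1 n = toℚᵘ-fromℚᵘ (ℚᵘ.mkℚᵘ n 0)

/1-+ : ∀ m n → (m ℤ.+ n) / 1 ≡ m / 1 + n / 1
/1-+ m n = toℚᵘ-injective (R.begin
  toℚᵘ ((m ℤ.+ n) / 1)               R.≈⟨ toℚᵘ-/1 (m ℤ.+ n) ⟩
  ℚᵘ.mkℚᵘ (m ℤ.+ n) 0                R.≈⟨ ℚᵘ.*≡* (cong (ℤ._* pos 1) (cong₂ ℤ._+_ (ℤ.*-identityʳ m) (ℤ.*-identityʳ n))) ⟨
  ℚᵘ.mkℚᵘ m 0 ℚᵘ.+ ℚᵘ.mkℚᵘ n 0       R.≈⟨ ℚᵘ.+-cong (toℚᵘ-/1 m) (toℚᵘ-/1 n) ⟨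
  toℚᵘ (m / 1) ℚᵘ.+ toℚᵘ (n / 1)     R.≈⟨ toℚᵘ-homo-+ (m / 1) (n / 1) ⟨
  toℚᵘ (m / 1 + n / 1)               R.∎)
  where module R = ℚᵘ.≃-Reasoning

/1-* : ∀ m n → (m ℤ.* n) / 1 ≡ m / 1 * (n / 1)
/1-* m n = toℚᵘ-injective (R.begin
  toℚᵘ ((m ℤ.* n) / 1)               R.≈⟨ toℚᵘ-/1 (m ℤ.* n) ⟩
  ℚᵘ.mkℚᵘ m 0 ℚᵘ.* ℚᵘ.mkℚᵘ n 0       R.≈⟨ ℚᵘ.*-cong (toℚᵘ-/1 m) (toℚᵘ-/1 n) ⟨
  toℚᵘ (m / 1) ℚᵘ.* toℚᵘ (n / 1)     R.≈⟨ toℚᵘ-homo-* (m / 1) (n / 1) ⟨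
  toℚᵘ (m / 1 * (n / 1))             R.∎)
  where module R = ℚᵘ.≃-Reasoning

*-↧ₙ : ∀ x → x * ι (↧ₙ x) ≡ ↥ x / 1
*-↧ₙ x@record{} = toℚᵘ-injective (R.begin
  toℚᵘ (x * ι (↧ₙ x))                   R.≈⟨ toℚᵘ-homo-* x (ι (↧ₙ x)) ⟩
  toℚᵘ x ℚᵘ.* toℚᵘ (ι (↧ₙ x))           R.≈⟨ ℚᵘ.*-congˡ {toℚᵘ x} (toℚᵘ-/1 (↧ x)) ⟩
  toℚᵘ x ℚᵘ.* ℚᵘ.mkℚᵘ (↧ x) 0           R.≈⟨ ℚᵘ.*≡* (trans (ℤ.*-identityʳ _) (cong (λ k → ↥ x ℤ.* pos k) (sym (ℕ.*-identityʳ (↧ₙ x))))) ⟩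
  ℚᵘ.mkℚᵘ (↥ x) 0                       R.≈⟨ toℚᵘ-/1 (↥ x) ⟨
  toℚᵘ (↥ x / 1)                        R.∎)
  where module R = ℚᵘ.≃-Reasoning

-- Cross-multiplication gives ↥ x · d = n · ↧ x, and the denominator, being coprime to the
-- numerator, must divide d.
↧ₙ-∣ : ∀ x d n → x * ι d ≡ n / 1 → ↧ₙ x ∣ d
↧ₙ-∣ x@(mkℚ _ _ c) d n eq = Coprimality.coprime-divisor
  (Coprimality.sym (Coprimality.recompute c))
  (ℕ.divides ℤ.∣ n ∣ (begin
    ℤ.∣ ↥ x ∣ ℕ.* d          ≡⟨ ℤ.abs-* (↥ x) (pos d) ⟨
    ℤ.∣ ↥ x ℤ.* pos d ∣        ≡⟨ cong ℤ.∣_∣ numerators ⟩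
    ℤ.∣ n ℤ.* ↧ x ∣          ≡⟨ ℤ.abs-* n (↧ x) ⟩
    ℤ.∣ n ∣ ℕ.* ↧ₙ x         ∎))
  where
  module R = ℚᵘ.≃-Reasoning
  fractions : toℚᵘ x ℚᵘ.* ℚᵘ.mkℚᵘ (pos d) 0 ℚᵘ.≃ ℚᵘ.mkℚᵘ n 0
  fractions = R.begin
    toℚᵘ x ℚᵘ.* ℚᵘ.mkℚᵘ (pos d) 0   R.≈⟨ ℚᵘ.*-congˡ {toℚᵘ x} (toℚᵘ-/1 (pos d)) ⟨
    toℚᵘ x ℚᵘ.* toℚᵘ (ι d)        R.≈⟨ toℚᵘ-homo-* x (ι d) ⟨
    toℚᵘ (x * ι d)                R.≈⟨ ℚᵘ.≃-reflexive (cong toℚᵘ eq) ⟩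
    toℚᵘ (n / 1)                  R.≈⟨ toℚᵘ-/1 n ⟩
    ℚᵘ.mkℚᵘ n 0                   R.∎
  numerators : ↥ x ℤ.* pos d ≡ n ℤ.* ↧ x
  numerators with fractions
  ... | ℚᵘ.*≡* eq′ = trans (sym (ℤ.*-identityʳ _)) (trans eq′ (cong (λ k → n ℤ.* pos k) (ℕ.*-identityʳ (↧ₙ x))))

∣x∣²≡x² : ∀ n → pos (ℤ.∣ n ∣ ℕ.* ℤ.∣ n ∣) ≡ n ℤ.* n
∣x∣²≡x² (pos n)    = ℤ.pos-* n n
∣x∣²≡x² -[1+ n ] = refl

module Localization (p : ℕ) (p-prime : Prime p) where

  p∤1 : p ∤ 1
  p∤1 p∣1 = ℕ.nonTrivial⇒≢1 {{prime⇒nonTrivial p-prime}} (ℕ.∣1⇒≡1 p∣1)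

  ∤-* : ∀ {m n} → p ∤ m → p ∤ n → p ∤ m ℕ.* n
  ∤-* {m} {n} p∤m p∤n p∣mn = [ p∤m , p∤n ]′ (euclidsLemma m n p-prime p∣mn)

  -- Wraps `_∈ℤ₍_₎`, which unfolds to a negated divisibility, so that x can be inferred from the
  -- type.
  record Integral (x : ℚ) : Set where
    constructor integral
    field p∤↧ₙ : x ∈ℤ₍ p ₎
  open Integral

  -- Any denominator prime to p will do, since the reduced one divides it. Closure under sums and
  -- products can then use the product of the two denominators.
  Integral-intro : ∀ x d n → p ∤ d → x * ι d ≡ n / 1 → Integral x
  Integral-intro x d n p∤d eq = integral λ p∣↧x → p∤d (ℕ.∣-trans p∣↧x (↧ₙ-∣ x d n eq))

  Integral-/1 : ∀ n → Integral (n / 1)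
  Integral-/1 n = Integral-intro (n / 1) 1 n p∤1 (*-identityʳ (n / 1))

  Integral-ι : ∀ n → Integral (ι n)
  Integral-ι n = Integral-/1 (pos n)

  Integral-* : ∀ {x y} → Integral x → Integral y → Integral (x * y)
  Integral-* {x} {y} x∈ y∈ = Integral-intro (x * y) (↧ₙ x ℕ.* ↧ₙ y) (↥ x ℤ.* ↥ y) (∤-* (p∤↧ₙ x∈) (p∤↧ₙ y∈)) (begin
    x * y * ι (↧ₙ x ℕ.* ↧ₙ y)           ≡⟨ cong (x * y *_) (ι-* (↧ₙ x) (↧ₙ y)) ⟩
    x * y * (ι (↧ₙ x) * ι (↧ₙ y))       ≡⟨ solve 4 (λ x y d e →
      x :* y :* (d :* e) := (x :* d) :* (y :* e))
    refl x y (ι (↧ₙ x)) (ι (↧ₙ y)) ⟩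
    (x * ι (↧ₙ x)) * (y * ι (↧ₙ y))     ≡⟨ cong₂ _*_ (*-↧ₙ x) (*-↧ₙ y) ⟩
    ↥ x / 1 * (↥ y / 1)                 ≡⟨ /1-* (↥ x) (↥ y) ⟨
    (↥ x ℤ.* ↥ y) / 1                   ∎)

  Integral-+ : ∀ {x y} → Integral x → Integral y → Integral (x + y)
  Integral-+ {x} {y} x∈ y∈ = Integral-intro (x + y) (↧ₙ x ℕ.* ↧ₙ y) (↥ x ℤ.* ↧ y ℤ.+ ↥ y ℤ.* ↧ x) (∤-* (p∤↧ₙ x∈) (p∤↧ₙ y∈)) (begin
    (x + y) * ι (↧ₙ x ℕ.* ↧ₙ y)           ≡⟨ cong ((x + y) *_) (ι-* (↧ₙ x) (↧ₙ y)) ⟩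
    (x + y) * (ι (↧ₙ x) * ι (↧ₙ y))       ≡⟨ solve 4 (λ x y d e →
      (x :+ y) :* (d :* e) := (x :* d) :* e :+ (y :* e) :* d)
    refl x y (ι (↧ₙ x)) (ι (↧ₙ y)) ⟩
    (x * ι (↧ₙ x)) * ι (↧ₙ y) + (y * ι (↧ₙ y)) * ι (↧ₙ x)
                                          ≡⟨ cong₂ (λ u v → u * ι (↧ₙ y) + v * ι (↧ₙ x)) (*-↧ₙ x) (*-↧ₙ y) ⟩
    ↥ x / 1 * (↧ y / 1) + ↥ y / 1 * (↧ x / 1)
                                          ≡⟨ cong₂ _+_ (/1-* (↥ x) (↧ y)) (/1-* (↥ y) (↧ x)) ⟨
    (↥ x ℤ.* ↧ y) / 1 + (↥ y ℤ.* ↧ x) / 1 ≡⟨ /1-+ (↥ x ℤ.* ↧ y) (↥ y ℤ.* ↧ x) ⟨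
    (↥ x ℤ.* ↧ y ℤ.+ ↥ y ℤ.* ↧ x) / 1     ∎)

  Integral-neg : ∀ {x} → Integral x → Integral (- x)
  Integral-neg {x} x∈ = subst Integral (solve 1 (λ x → con (- 1ℚ) :* x := :- x) refl x) (Integral-* {x = - 1ℚ} (Integral-/1 -[1+ 0 ]) x∈)

  Integral-- : ∀ {x y} → Integral x → Integral y → Integral (x - y)
  Integral-- x∈ y∈ = Integral-+ x∈ (Integral-neg y∈)

  Integral-^ : ∀ {x} k → Integral x → Integral (x ^ k)
  Integral-^ zero    x∈ = Integral-ι 1
  Integral-^ (suc k) x∈ = Integral-* x∈ (Integral-^ k x∈)

  Integral-∑ : ∀ n {f} → (∀ k → k ℕ.< n → Integral (f k)) → Integral (∑< n f)
  Integral-∑ zero    f∈ = Integral-ι 0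
  Integral-∑ (suc n) f∈ = Integral-+ (Integral-∑ n (λ k k<n → f∈ k (ℕ.m<n⇒m<1+n k<n))) (f∈ n (ℕ.n<1+n n))

  -- The ideals generated by powers of p, and congruences

  record Multiple (k : ℕ) (x : ℚ) : Set where
    constructor multiple
    field
      {quotient} : ℚ
      quotient-integral : Integral quotient
      equality : x ≡ ι p ^ k * quotient

  Multiple⇒Integral : ∀ {k x} → Multiple k x → Integral x
  Multiple⇒Integral {k} (multiple {y} y∈ refl) = Integral-* (Integral-^ k (Integral-ι p)) y∈

  Multiple-*ˡ : ∀ {k x y} → Integral y → Multiple k x → Multiple k (y * x)
  Multiple-*ˡ {k} {y = y} y∈ (multiple {z} z∈ refl) = multiple (Integral-* y∈ z∈)
    (solve 3 (λ y q z → y :* (q :* z) := q :* (y :* z)) refl y (ι p ^ k) z)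

  Multiple-* : ∀ {j k x y} → Multiple j x → Multiple k y → Multiple (j ℕ.+ k) (x * y)
  Multiple-* {j} {k} (multiple {x} x∈ refl) (multiple {y} y∈ refl) = multiple (Integral-* x∈ y∈) (begin
    ι p ^ j * x * (ι p ^ k * y)     ≡⟨ solve 4 (λ q x r y →
      q :* x :* (r :* y) := q :* r :* (x :* y))
    refl (ι p ^ j) x (ι p ^ k) y ⟩
    ι p ^ j * ι p ^ k * (x * y)     ≡⟨ cong (_* (x * y)) (^-homo-* (ι p) j k) ⟨
    ι p ^ (j ℕ.+ k) * (x * y)       ∎)

  Multiple-+ : ∀ {k x y} → Multiple k x → Multiple k y → Multiple k (x + y)
  Multiple-+ {k} (multiple {x} x∈ refl) (multiple {y} y∈ refl) = multiple (Integral-+ x∈ y∈) (sym (*-distribˡ-+ (ι p ^ k) x y))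

  Multiple-neg : ∀ {k x} → Multiple k x → Multiple k (- x)
  Multiple-neg {k} (multiple {x} x∈ refl) = multiple (Integral-neg x∈) (neg-distribʳ-* (ι p ^ k) x)

  ∣⇒Multiple : ∀ {n} → p ∣ n → Multiple 1 (ι n)
  ∣⇒Multiple (ℕ.divides q refl) = multiple (Integral-ι q)
    (trans (ι-* q p) (solve 2 (λ q p → q :* p := p :^ 1 :* q) refl (ι q) (ι p)))

  pᵏ≢0 : ∀ k → ι p ^ k ≢ 0ℚ
  pᵏ≢0 k = ^-≢0 k (ι≢0 p {{prime⇒nonZero p-prime}})

  Multiple-÷₀ : ∀ {k x} → Multiple k x → Integral (x ÷₀ ι p ^ k)
  Multiple-÷₀ {k} {x} (multiple {y} y∈ eq) = subst Integral (*-cancelʳ-≢0 _ _ (ι p ^ k) (pᵏ≢0 k) (begin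
    y * ι p ^ k                   ≡⟨ *-comm y (ι p ^ k) ⟩
    ι p ^ k * y                   ≡⟨ eq ⟨
    x                             ≡⟨ ÷₀-*-cancel x (ι p ^ k) (pᵏ≢0 k) ⟨
    (x ÷₀ ι p ^ k) * ι p ^ k      ∎)) y∈

  -- A congruence asks for integrality of both sides, but one side and the difference determine the
  -- other. This spares a direct proof for the sums with divisors a + k and a + k - 1, which p may
  -- divide.
  ≡-mod-fromʳ : ∀ {k} x y → Integral y → Multiple k (x - y) → x ≡ y [mod p ^ k ]
  ≡-mod-fromʳ x y y∈ m =
    p∤↧ₙ (subst Integral (solve 2 (λ x y → y :+ (x :- y) := x) refl x y) (Integral-+ y∈ (Multiple⇒Integral m))) ,
    p∤↧ₙ y∈ , p∤↧ₙ (Multiple-÷₀ m)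

  ≡-mod-fromˡ : ∀ {k} x y → Integral x → Multiple k (x - y) → x ≡ y [mod p ^ k ]
  ≡-mod-fromˡ x y x∈ m =
    p∤↧ₙ x∈ ,
    p∤↧ₙ (subst Integral (solve 2 (λ x y → x :- (x :- y) := y) refl x y) (Integral-- x∈ (Multiple⇒Integral m))) ,
    p∤↧ₙ (Multiple-÷₀ m)

  -- Units of the localization

  record Unit (x : ℚ) : Set where
    constructor unit
    field
      {inverse} : ℚ
      inverse-integral : Integral inverse
      inverse-* : inverse * x ≡ 1ℚ
  open Unit

  Unit-≢0 : ∀ {x} → Unit x → x ≢ 0ℚ
  Unit-≢0 (unit {w} _ wx≡1) refl with trans (sym (*-zeroʳ w)) wx≡1
  ... | ()

  Unit-* : ∀ {x y} → Unit x → Unit y → Unit (x * y)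
  Unit-* {x} {y} (unit {v} v∈ vx≡1) (unit {w} w∈ wy≡1) = unit (Integral-* v∈ w∈)
    (trans (solve 4 (λ v w x y → v :* w :* (x :* y) := (v :* x) :* (w :* y)) refl v w x y) (cong₂ _*_ vx≡1 wy≡1))

  Unit-^ : ∀ {x} k → Unit x → Unit (x ^ k)
  Unit-^ zero    _ = unit (Integral-ι 1) refl
  Unit-^ (suc k) u = Unit-* u (Unit-^ k u)

  ∤⇒Unit : ∀ {n} → p ∤ n → Unit (ι n)
  ∤⇒Unit {zero}  p∤0 = contradiction (p ℕ.∣0) p∤0
  ∤⇒Unit {suc n} p∤n = unit (Integral-intro w (suc n) (pos 1) p∤n eq) eq
    where
    w = 1ℚ ÷₀ ι (suc n)
    eq = ÷₀-*-cancel 1ℚ (ι (suc n)) (ι≢0 (suc n))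

  ÷₀-Unit : ∀ {x y} (u : Unit y) → inverse u * x ≡ x ÷₀ y
  ÷₀-Unit {x} {y} u@(unit {w} _ wy≡1) = *-cancelʳ-≢0 _ _ y (Unit-≢0 u) (begin
    w * x * y       ≡⟨ solve 3 (λ w x y → w :* x :* y := w :* y :* x) refl w x y ⟩
    w * y * x       ≡⟨ cong (_* x) wy≡1 ⟩
    1ℚ * x          ≡⟨ *-identityˡ x ⟩
    x               ≡⟨ ÷₀-*-cancel x y (Unit-≢0 u) ⟨
    (x ÷₀ y) * y    ∎)

  Integral-÷₀ : ∀ {x y} → Integral x → Unit y → Integral (x ÷₀ y)
  Integral-÷₀ x∈ u = subst Integral (÷₀-Unit u) (Integral-* (inverse-integral u) x∈)

  Multiple-÷₀-Unit : ∀ {k x y} → Multiple k x → Unit y → Multiple k (x ÷₀ y)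
  Multiple-÷₀-Unit {k} m u = subst (Multiple k) (÷₀-Unit u) (Multiple-*ˡ (inverse-integral u) m)

  Multiple-cancel : ∀ {k x} y → Unit y → Multiple k (y * x) → Multiple k x
  Multiple-cancel {k} {x} y (unit {w} w∈ wy≡1) m = subst (Multiple k)
    (trans (sym (*-assoc w y x)) (trans (cong (_* x) wy≡1) (*-identityˡ x))) (Multiple-*ˡ w∈ m)

  ∤-! : ∀ {k} → k ℕ.< p → p ∤ k !
  ∤-! {zero}  _ = p∤1
  ∤-! {suc k} k<p = ∤-* (ℕ.>⇒∤ k<p) (∤-! (ℕ.<-trans (ℕ.n<1+n k) k<p))

  -- Inverses and residues modulo p

  ∤-inverse : ∀ {d} → p ∤ d → ∃ λ e → ∃ λ f → e / 1 * ι d ≡ 1ℚ + f / 1 * ι p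
  ∤-inverse {d} p∤d with ℤ-inverse
    where
    coprime : Coprime d p
    coprime {e} (e∣d , e∣p) with prime⇒irreducible p-prime e∣p
    ... | inj₁ e≡1  = e≡1
    ... | inj₂ refl = contradiction e∣d p∤d
    module ℤS = ℤ.+-*-Solver
    +-1+* : ∀ m n → pos (1 ℕ.+ m ℕ.* n) ≡ pos 1 ℤ.+ pos m ℤ.* pos n
    +-1+* m n = cong (λ i → pos 1 ℤ.+ i) (ℤ.pos-* m n)
    ℤ-inverse : ∃ λ e → ∃ λ f → e ℤ.* pos d ≡ pos 1 ℤ.+ f ℤ.* pos p
    ℤ-inverse with Coprimality.coprime-Bézout coprime
    ... | Bézout.+- x y eq = pos x , pos y , trans (sym (ℤ.pos-* x d)) (trans (cong pos (sym eq)) (+-1+* y p))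
    -- Here 1 + x d = y p over the naturals, so both coefficients change sign.
    ... | Bézout.-+ x y eq = ℤ.- (pos x) , ℤ.- (pos y) , (begin
      ℤ.- (pos x) ℤ.* pos d
        ≡⟨ ℤS.solve 2 (λ x d → (ℤS.:- x) ℤS.:* d ℤS.:= ℤS.con (pos 1) ℤS.:- (ℤS.con (pos 1) ℤS.:+ x ℤS.:* d)) refl (pos x) (pos d) ⟩
      pos 1 ℤ.- (pos 1 ℤ.+ pos x ℤ.* pos d)
        ≡⟨ cong (λ u → pos 1 ℤ.- u) (trans (sym (+-1+* x d)) (trans (cong pos eq) (ℤ.pos-* y p))) ⟩
      pos 1 ℤ.- (pos y ℤ.* pos p)
        ≡⟨ ℤS.solve 2 (λ y p → ℤS.con (pos 1) ℤS.:- y ℤS.:* p ℤS.:= ℤS.con (pos 1) ℤS.:+ (ℤS.:- y) ℤS.:* p) refl (pos y) (pos p) ⟩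
      pos 1 ℤ.+ ℤ.- (pos y) ℤ.* pos p ∎)
  ... | e , f , eq = e , f , (begin
    e / 1 * ι d              ≡⟨ /1-* e (pos d) ⟨
    (e ℤ.* pos d) / 1          ≡⟨ cong (λ i → i / 1) eq ⟩
    (pos 1 ℤ.+ f ℤ.* pos p) / 1  ≡⟨ trans (/1-+ (pos 1) (f ℤ.* pos p)) (cong (λ u → 1ℚ + u) (/1-* f (pos p))) ⟩
    1ℚ + f / 1 * ι p         ∎)

  -- With e inverse to the denominator d modulo p, say e d = 1 + f p, write x = e (x d) - x f p.
  -- Here x d is the numerator q p, so p factors out of both parts.
  ∣↥⇒Multiple : ∀ {x} → Integral x → pos p ℤ.∣ ↥ x → Multiple 1 x
  ∣↥⇒Multiple {x} x∈ (ℤ.divides q n≡qp) = multiple (Integral-- (Integral-* (Integral-/1 e) (Integral-/1 q)) (Integral-* x∈ (Integral-/1 f))) (begin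
    x
      ≡⟨ solve 3 (λ x f p → x := x :* (con 1ℚ :+ f :* p) :- x :* f :* p) refl x (f / 1) (ι p) ⟩
    x * (1ℚ + f / 1 * ι p) - x * (f / 1) * ι p
      ≡⟨ cong (λ u → x * u - x * (f / 1) * ι p) eq ⟨
    x * (e / 1 * d) - x * (f / 1) * ι p
      ≡⟨ solve 5 (λ x e d f p →
           x :* (e :* d) :- x :* f :* p := e :* (x :* d) :- x :* f :* p)
         refl x (e / 1) d (f / 1) (ι p) ⟩
    e / 1 * (x * d) - x * (f / 1) * ι p
      ≡⟨ cong (λ u → e / 1 * u - x * (f / 1) * ι p) (trans (*-↧ₙ x) (trans (cong (λ i → i / 1) n≡qp) (/1-* q (pos p)))) ⟩
    e / 1 * (q / 1 * ι p) - x * (f / 1) * ι p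
      ≡⟨ solve 5 (λ x e q f p →
           e :* (q :* p) :- x :* f :* p := p :^ 1 :* (e :* q :- x :* f))
         refl x (e / 1) (q / 1) (f / 1) (ι p) ⟩
    ι p ^ 1 * (e / 1 * (q / 1) - x * (f / 1)) ∎)
    where
    d = ι (↧ₙ x)
    e f : ℤ
    e = proj₁ (∤-inverse (p∤↧ₙ x∈))
    f = proj₁ (proj₂ (∤-inverse (p∤↧ₙ x∈)))
    eq : e / 1 * d ≡ 1ℚ + f / 1 * ι p
    eq = proj₂ (proj₂ (∤-inverse (p∤↧ₙ x∈)))

  -- The localization is a local ring with maximal ideal generated by p. The inverse of n / d is
  -- taken as d n / n², because n² is a natural number and `∤⇒Unit` applies to it.
  ¬Multiple⇒Unit : ∀ {x} → Integral x → ¬ Multiple 1 x → Unit x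
  ¬Multiple⇒Unit {x} x∈ ¬m = unit (Integral-* v∈ (Integral-* (Integral-ι (↧ₙ x)) (Integral-/1 n))) (begin
    v * (d * (n / 1)) * x         ≡⟨ solve 4 (λ v d n x →
      v :* (d :* n) :* x := v :* (n :* (x :* d)))
    refl v d (n / 1) x ⟩
    v * (n / 1 * (x * d))         ≡⟨ cong (λ u → v * (n / 1 * u)) (*-↧ₙ x) ⟩
    v * (n / 1 * (n / 1))         ≡⟨ cong (v *_) (trans (cong (λ i → i / 1) (∣x∣²≡x² n)) (/1-* n n)) ⟨
    v * ι (ℤ.∣ n ∣ ℕ.* ℤ.∣ n ∣)   ≡⟨ vn²≡1 ⟩
    1ℚ                            ∎)
    where
    n = ↥ x
    d = ι (↧ₙ x)
    p∤n : p ∤ ℤ.∣ n ∣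
    p∤n p∣n = ¬m (∣↥⇒Multiple x∈ (ℤ.∣ᵤ⇒∣ p∣n))
    n²-unit = ∤⇒Unit (∤-* p∤n p∤n)
    v = inverse n²-unit
    v∈ = inverse-integral n²-unit
    vn²≡1 = inverse-* n²-unit

  -- The residue field is ℤ/p: r is the numerator times an inverse of the denominator, reduced
  -- modulo p.
  residue : ∀ {x} → Integral x → ∃ λ r → r ℕ.< p × Multiple 1 (x - ι r)
  residue {x} x∈ = r , ℤ.n%ℕd<d n p , multiple (Integral-- (Integral-/1 q) (Integral-* x∈ (Integral-/1 f))) (begin
    x - ι r
      ≡⟨ solve 4 (λ x f p r →
           x :- r := x :* (con 1ℚ :+ f :* p) :- x :* f :* p :- r)
         refl x (f / 1) (ι p) (ι r) ⟩
    x * (1ℚ + f / 1 * ι p) - x * (f / 1) * ι p - ι r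
      ≡⟨ cong (λ u → x * u - x * (f / 1) * ι p - ι r) eq ⟨
    x * (e / 1 * d) - x * (f / 1) * ι p - ι r
      ≡⟨ solve 6 (λ x e d f p r →
           x :* (e :* d) :- x :* f :* p :- r := x :* d :* e :- x :* f :* p :- r)
         refl x (e / 1) d (f / 1) (ι p) (ι r) ⟩
    x * d * (e / 1) - x * (f / 1) * ι p - ι r
      ≡⟨ cong (λ u → u - x * (f / 1) * ι p - ι r) xde≡ ⟩
    ι r + q / 1 * ι p - x * (f / 1) * ι p - ι r
      ≡⟨ solve 5 (λ x q f p r →
           r :+ q :* p :- x :* f :* p :- r := p :^ 1 :* (q :- x :* f))
         refl x (q / 1) (f / 1) (ι p) (ι r) ⟩
    ι p ^ 1 * (q / 1 - x * (f / 1)) ∎)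
    where
    instance _ = prime⇒nonZero p-prime
    d = ι (↧ₙ x)
    e f : ℤ
    e = proj₁ (∤-inverse (p∤↧ₙ x∈))
    f = proj₁ (proj₂ (∤-inverse (p∤↧ₙ x∈)))
    eq : e / 1 * d ≡ 1ℚ + f / 1 * ι p
    eq = proj₂ (proj₂ (∤-inverse (p∤↧ₙ x∈)))
    n = ↥ x ℤ.* e
    r = n ℤ.%ℕ p
    q = n ℤ./ℕ p
    xde≡ : x * d * (e / 1) ≡ ι r + q / 1 * ι p
    xde≡ = begin
      x * d * (e / 1)                  ≡⟨ cong (_* (e / 1)) (*-↧ₙ x) ⟩
      ↥ x / 1 * (e / 1)                ≡⟨ /1-* (↥ x) e ⟨
      n / 1                            ≡⟨ cong (λ i → i / 1) (ℤ.a≡a%ℕn+[a/ℕn]*n n p) ⟩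
      (pos r ℤ.+ q ℤ.* pos p) / 1          ≡⟨ trans (/1-+ (pos r) (q ℤ.* pos p)) (cong (λ u → ι r + u) (/1-* q (pos p))) ⟩
      ι r + q / 1 * ι p                ∎

  -- Falling factorials and binomials modulo p

  Integral-falling : ∀ {x} k → Integral x → Integral (falling x k)
  Integral-falling zero    x∈ = Integral-ι 1
  Integral-falling (suc k) x∈ = Integral-* (Integral-falling k x∈) (Integral-- x∈ (Integral-ι k))

  -- The factor x - r occurs in the product as soon as r < k.
  Multiple-falling : ∀ {x r} k → Integral x → r ℕ.< k → Multiple 1 (x - ι r) → Multiple 1 (falling x k)
  Multiple-falling {x} {r} (suc k) x∈ r<1+k m with ℕ.m<1+n⇒m<n∨m≡n r<1+k
  ... | inj₁ r<k  = subst (Multiple 1) (*-comm (x - ι k) (falling x k)) (Multiple-*ˡ (Integral-- x∈ (Integral-ι k)) (Multiple-falling k x∈ r<k m))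
  ... | inj₂ refl = Multiple-*ˡ (Integral-falling k x∈) m

  !-Unit : ∀ {k} → k ℕ.< p → Unit (ι (k !))
  !-Unit k<p = ∤⇒Unit (∤-! k<p)

  Integral-binom : ∀ {x k} → Integral x → k ℕ.< p → Integral (binom x k)
  Integral-binom {k = k} x∈ k<p = Integral-÷₀ (Integral-falling k x∈) (!-Unit k<p)

-- Divisibility of the boundary terms by p³

module OddPrime (m : ℕ) (p-prime : Prime (suc m)) (p≢2 : suc m ≢ 2) where

  p : ℕ
  p = suc m

  open Localization p p-prime

  p∤2 : p ∤ 2
  p∤2 p∣2 with prime⇒irreducible prime[2] p∣2
  ... | inj₁ p≡1 = ℕ.nonTrivial⇒≢1 {{prime⇒nonTrivial p-prime}} p≡1
  ... | inj₂ p≡2 = p≢2 p≡2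

  Unit-ι2 : Unit (ι 2)
  Unit-ι2 = ∤⇒Unit p∤2

  Unit-ι4 : Unit (ι 4)
  Unit-ι4 = ∤⇒Unit (∤-* p∤2 p∤2)

  Integral-central : ∀ k → Integral (central k)
  Integral-central k = Integral-÷₀ (Integral-ι ((2 ℕ.* k) C k)) (Unit-^ k Unit-ι4)

  Integral-term : ∀ {a k} → Integral a → k ℕ.< p → Integral (term a k)
  Integral-term {k = k} a∈ k<p = Integral-* (Integral-* (Integral-binom a∈ k<p)
    (Integral-binom (Integral-- (Integral-neg (Integral-ι 1)) a∈) k<p)) (Integral-central k)

  Integral-S : ∀ {a} → Integral a → Integral (S p a)
  Integral-S a∈ = Integral-∑ p (λ k k<p → Integral-term a∈ k<p)

  -- The residue r of x lies in 0, ..., p - 1 and is not m = p - 1, because x ≢ -1. So x - r is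
  -- among the m factors of the numerator, while m! is a unit.
  Multiple-binom : ∀ {x} → Integral x → ¬ Multiple 1 (x + 1ℚ) → Multiple 1 (binom x m)
  Multiple-binom {x} x∈ x≢-1 =
    Multiple-÷₀-Unit (Multiple-falling m x∈ r<m x≡r) (!-Unit (ℕ.n<1+n m))
    where
    r = proj₁ (residue x∈)
    x≡r : Multiple 1 (x - ι r)
    x≡r = proj₂ (proj₂ (residue x∈))
    r≢m : r ≢ m
    r≢m r≡m = x≢-1 (subst (Multiple 1) (begin
      x - ι r + ι (suc m)     ≡⟨ cong₂ (λ i u → x - ι i + u) r≡m (ι-suc m) ⟩
      x - ι m + (1ℚ + ι m)    ≡⟨ solve 2 (λ x j → x :- j :+ (con 1ℚ :+ j) := x :+ con 1ℚ) refl x (ι m) ⟩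
      x + 1ℚ                  ∎) (Multiple-+ x≡r (∣⇒Multiple ℕ.∣-refl)))
    r<m : r ℕ.< m
    r<m = ℕ.≤∧≢⇒< (ℕ.s≤s⁻¹ (proj₁ (proj₂ (residue x∈)))) r≢m

  -- The product of this coefficient with m!² is (2m)!, which p divides since p ≤ 2m; but p does not
  -- divide m!.
  p∣C-central : p ∣ (2 ℕ.* m) C m
  p∣C-central = [ (λ p∣C → p∣C) , (λ p∣m!m! → contradiction p∣m!m! (∤-* p∤m! p∤m!)) ]′
    (euclidsLemma ((2 ℕ.* m) C m) (m ! ℕ.* m !) p-prime (subst (p ∣_) (sym (C-central-! m)) p∣[2m]!))
    where
    p∤m! : p ∤ m !
    p∤m! = ∤-! (ℕ.n<1+n m)
    1<p : 1 ℕ.< p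
    1<p = ℕ.nonTrivial⇒n>1 p {{prime⇒nonTrivial p-prime}}
    p≤2m : p ℕ.≤ 2 ℕ.* m
    p≤2m = ℕ.+-mono-≤ (ℕ.s≤s⁻¹ 1<p) (ℕ.m≤m+n m 0)
    p∣[2m]! : p ∣ (2 ℕ.* m) !
    p∣[2m]! = ℕ.∣-trans (ℕ.m∣m*n (m !)) (ℕ.m≤n⇒m!∣n! p≤2m)

  Multiple-central : Multiple 1 (central m)
  Multiple-central = Multiple-÷₀-Unit (∣⇒Multiple p∣C-central) (Unit-^ m Unit-ι4)

  ¬Multiple-from : ∀ x y → ¬ (x ≡ y [mod p ^ 1 ]) → Integral y → ¬ Multiple 1 (x - y)
  ¬Multiple-from x y x≢y y∈ m = x≢y (≡-mod-fromʳ x y y∈ m)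

  module _ (a : ℚ) (a∈ : Integral a) (a≢0 : ¬ Multiple 1 a) (a≢1 : ¬ Multiple 1 (a - 1ℚ)) (a≢-1 : ¬ Multiple 1 (a + 1ℚ)) where

    Multiple-term : Multiple 3 (term a m)
    Multiple-term = Multiple-* (Multiple-* (Multiple-binom a∈ a≢-1) (Multiple-binom -1-a∈ -1-a≢-1)) Multiple-central
      where
      -1-a∈ : Integral (- 1ℚ - a)
      -1-a∈ = Integral-- (Integral-neg (Integral-ι 1)) a∈
      -- The condition on the argument -1 - a concerns (-1 - a) + 1 = -a, so it amounts to a ≢ 0.
      -1-a≢-1 : ¬ Multiple 1 (- 1ℚ - a + 1ℚ)
      -1-a≢-1 h = a≢0 (subst (Multiple 1) (solve 1 (λ a → :- (con (- 1ℚ) :- a :+ con 1ℚ) := a) refl a) (Multiple-neg h))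

    Unit-a : Unit a
    Unit-a = ¬Multiple⇒Unit a∈ a≢0

    Unit-a-1 : Unit (a - 1ℚ)
    Unit-a-1 = ¬Multiple⇒Unit (Integral-- a∈ (Integral-ι 1)) a≢1

    -- Since m = p - 1, a + m = (a - 1) + p, which is congruent to a - 1.
    Unit-a+m : Unit (a + ι m)
    Unit-a+m = ¬Multiple⇒Unit (Integral-+ a∈ (Integral-ι m)) λ h → a≢1 (subst (Multiple 1) (begin
      a + ι m - ι (suc m)       ≡⟨ cong (λ u → a + ι m - u) (ι-suc m) ⟩
      a + ι m - (1ℚ + ι m)      ≡⟨ solve 2 (λ a j → a :+ j :- (con 1ℚ :+ j) := a :- con 1ℚ) refl a (ι m) ⟩
      a - 1ℚ                    ∎) (Multiple-+ h (Multiple-neg (∣⇒Multiple ℕ.∣-refl))))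

    Multiple-term/₀ : Multiple 3 (term/₀ a m)
    Multiple-term/₀ = Multiple-cancel (a + ι m) Unit-a+m
      (subst (Multiple 3) (trans (sym (term/₀-* a m (Unit-≢0 Unit-a))) (*-comm (term/₀ a m) (a + ι m))) Multiple-term)

    -- The four congruences modulo p³

    b c X Y T L₀ M₀ R₀ L₁ M₁ R₁ q₁ q₂ q₃ q₄ q₅ q₆ q₇ q₈ : ℚ
    b = a + 1ℚ
    c = a - 1ℚ
    X = S p a
    Y = S p b
    T = ∑[ k < m ] (term a k ÷₀ ι (suc k))
    q₁ = 1ℚ ÷₀ (ι 2 * a)
    q₂ = b ^ 2 ÷₀ (ι 2 * a ^ 3)
    q₃ = b ÷₀ (ι 2 * a ^ 2)
    q₄ = 1ℚ ÷₀ (ι 2 * a ^ 2)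
    q₅ = (c ^ 2 + 1ℚ) ÷₀ (ι 2 * c ^ 3)
    q₆ = b ^ 2 ÷₀ (ι 2 * a ^ 2 * c)
    q₇ = b ÷₀ (ι 2 * a * c)
    q₈ = (a ^ 2 - ι 3 * a + 1ℚ) ÷₀ (ι 2 * a * c ^ 3)
    L₀ = ∑[ k < p ] term/₀ a k
    M₀ = q₁ * X + q₂ * Y
    R₀ = q₃ * T - q₄ * X
    L₁ = ∑[ k < p ] term/₁ a k
    M₁ = q₅ * X + q₆ * Y
    R₁ = q₇ * T - q₈ * X

    Unit-2a : Unit (ι 2 * a)
    Unit-2a = Unit-* Unit-ι2 Unit-a

    Unit-2a² : Unit (ι 2 * a ^ 2)
    Unit-2a² = Unit-* Unit-ι2 (Unit-^ 2 Unit-a)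

    Unit-2a³ : Unit (ι 2 * a ^ 3)
    Unit-2a³ = Unit-* Unit-ι2 (Unit-^ 3 Unit-a)

    Unit-2c³ : Unit (ι 2 * c ^ 3)
    Unit-2c³ = Unit-* Unit-ι2 (Unit-^ 3 Unit-a-1)

    Unit-2a²c : Unit (ι 2 * a ^ 2 * c)
    Unit-2a²c = Unit-* Unit-2a² Unit-a-1

    Unit-2ac : Unit (ι 2 * a * c)
    Unit-2ac = Unit-* Unit-2a Unit-a-1

    Unit-2ac³ : Unit (ι 2 * a * c ^ 3)
    Unit-2ac³ = Unit-* Unit-2a (Unit-^ 3 Unit-a-1)

    Unit-2a²c³ : Unit (ι 2 * a ^ 2 * c ^ 3)
    Unit-2a²c³ = Unit-* Unit-2a² (Unit-^ 3 Unit-a-1)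

    ÷₀-cancel-Unit : ∀ x {y} → Unit y → (x ÷₀ y) * y ≡ x
    ÷₀-cancel-Unit x {y} u = ÷₀-*-cancel x y (Unit-≢0 u)

    b∈ : Integral b
    b∈ = Integral-+ a∈ (Integral-ι 1)

    Integral-M₀ : Integral M₀
    Integral-M₀ = Integral-+ (Integral-* (Integral-÷₀ (Integral-ι 1) Unit-2a) (Integral-S a∈))
      (Integral-* (Integral-÷₀ (Integral-^ 2 b∈) Unit-2a³) (Integral-S b∈))

    Integral-M₁ : Integral M₁
    Integral-M₁ = Integral-+
      (Integral-* (Integral-÷₀ (Integral-+ (Integral-^ 2 (Integral-- a∈ (Integral-ι 1))) (Integral-ι 1)) Unit-2c³) (Integral-S a∈))
      (Integral-* (Integral-÷₀ (Integral-^ 2 b∈) Unit-2a²c) (Integral-S b∈))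

    Integral-2m+1 : Integral (ι 2 * ι m + 1ℚ)
    Integral-2m+1 = Integral-+ (Integral-* (Integral-ι 2) (Integral-ι m)) (Integral-ι 1)

    -- Multiplied by the unit 2a³, the difference is the left side of `telescope₀` at m = p - 1,
    -- whose right side is an integral multiple of `term a m`.
    L₀-M₀ : Multiple 3 (L₀ - M₀)
    L₀-M₀ = Multiple-cancel (ι 2 * a ^ 3) Unit-2a³ (subst (Multiple 3) eq
      (Multiple-neg (Multiple-*ˡ (Integral-* (Integral-+ (Integral-* (Integral-ι 2) a∈) (Integral-ι 1)) Integral-2m+1) Multiple-term)))
      where
      eq : - ((ι 2 * a + 1ℚ) * (ι 2 * ι m + 1ℚ) * term a m) ≡ ι 2 * a ^ 3 * (L₀ - M₀)
      eq = begin
        - ((ι 2 * a + 1ℚ) * (ι 2 * ι m + 1ℚ) * term a m)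
          ≡⟨ telescope₀ a m (Unit-≢0 Unit-a) ⟨
        ι 2 * a ^ 3 * L₀ - a ^ 2 * X - b ^ 2 * Y
          -- Each coefficient is rewritten as its quotient times the denominator, after which `q₁`
          -- and `q₂` can be treated as independent variables. The factor 1 is inserted to become
          -- `q₁` · 2a.
          ≡⟨ cong₂ (λ u v → ι 2 * a ^ 3 * L₀ - u - v * Y)
               (solve 2 (λ a X → a :^ 2 :* X := con 1ℚ :* a :^ 2 :* X) refl a X)
               (sym (÷₀-cancel-Unit (b ^ 2) Unit-2a³)) ⟩
        ι 2 * a ^ 3 * L₀ - 1ℚ * a ^ 2 * X - q₂ * (ι 2 * a ^ 3) * Y
          ≡⟨ cong (λ u → ι 2 * a ^ 3 * L₀ - u * a ^ 2 * X - q₂ * (ι 2 * a ^ 3) * Y) (÷₀-cancel-Unit 1ℚ Unit-2a) ⟨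
        ι 2 * a ^ 3 * L₀ - q₁ * (ι 2 * a) * a ^ 2 * X - q₂ * (ι 2 * a ^ 3) * Y
          ≡⟨ solve 6 (λ a L X Y q r →
               con (ι 2) :* a :^ 3 :* L :- q :* (con (ι 2) :* a) :* a :^ 2 :* X :- r :* (con (ι 2) :* a :^ 3) :* Y
               := con (ι 2) :* a :^ 3 :* (L :- (q :* X :+ r :* Y))) refl a L₀ X Y q₁ q₂ ⟩
        ι 2 * a ^ 3 * (L₀ - M₀) ∎

    Multiple-telescope-S : Multiple 3 (a * b * X + b ^ 2 * Y - a * b * T)
    Multiple-telescope-S = subst (Multiple 3) (sym (telescope-S a m))
      (Multiple-*ˡ (Integral-* b∈ (Integral-+ (Integral-* (Integral-ι 2) (Integral-+ a∈ (Integral-ι m))) (Integral-ι 1))) Multiple-term)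

    M₀-R₀ : Multiple 3 (M₀ - R₀)
    M₀-R₀ = Multiple-cancel (ι 2 * a ^ 3) Unit-2a³ (subst (Multiple 3) eq Multiple-telescope-S)
      where
      -- Abstracts the four numerators so that each can be replaced by quotient times denominator.
      -- The two X summands come from a (a + 1) = a² + a.
      expand : ℚ → ℚ → ℚ → ℚ → ℚ
      expand u v w z = u * a ^ 2 * X + v * Y - w * a * T + z * a * X
      eq : a * b * X + b ^ 2 * Y - a * b * T ≡ ι 2 * a ^ 3 * (M₀ - R₀)
      eq = begin
        a * b * X + b ^ 2 * Y - a * b * T
          ≡⟨ solve 4 (λ a X Y T → let b = a :+ con 1ℚ in
               a :* b :* X :+ b :^ 2 :* Y :- a :* b :* T
               := con 1ℚ :* a :^ 2 :* X :+ b :^ 2 :* Y :- b :* a :* T :+ con 1ℚ :* a :* X) refl a X Y T ⟩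
        expand 1ℚ (b ^ 2) b 1ℚ
          ≡⟨ cong₂ (λ u v → expand u v b 1ℚ) (÷₀-cancel-Unit 1ℚ Unit-2a) (÷₀-cancel-Unit (b ^ 2) Unit-2a³) ⟨
        expand (q₁ * (ι 2 * a)) (q₂ * (ι 2 * a ^ 3)) b 1ℚ
          ≡⟨ cong₂ (expand (q₁ * (ι 2 * a)) (q₂ * (ι 2 * a ^ 3))) (÷₀-cancel-Unit b Unit-2a²) (÷₀-cancel-Unit 1ℚ Unit-2a²) ⟨
        expand (q₁ * (ι 2 * a)) (q₂ * (ι 2 * a ^ 3)) (q₃ * (ι 2 * a ^ 2)) (q₄ * (ι 2 * a ^ 2))
          ≡⟨ solve 8 (λ a X Y T q₁ q₂ q₃ q₄ → let two = con (ι 2) in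
               q₁ :* (two :* a) :* a :^ 2 :* X :+ q₂ :* (two :* a :^ 3) :* Y
               :- q₃ :* (two :* a :^ 2) :* a :* T :+ q₄ :* (two :* a :^ 2) :* a :* X
               := two :* a :^ 3 :* (q₁ :* X :+ q₂ :* Y :- (q₃ :* T :- q₄ :* X))) refl a X Y T q₁ q₂ q₃ q₄ ⟩
        ι 2 * a ^ 3 * (M₀ - R₀) ∎

    -- As for `L₀-M₀`, with the unit 2a² (a - 1)³. The boundary term of `telescope₁` also contains
    -- `term/₀ a m`, hence the use of `Multiple-term/₀`.
    L₁-M₁ : Multiple 3 (L₁ - M₁)
    L₁-M₁ = Multiple-cancel (ι 2 * a ^ 2 * c ^ 3) Unit-2a²c³ (subst (Multiple 3) eq
      (Multiple-*ˡ Integral-2m+1 (Multiple-+ (Multiple-*ˡ e∈ Multiple-term)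
        (Multiple-neg (Multiple-*ˡ (Integral-* (Integral-ι 2) (Integral-^ 3 a∈)) Multiple-term/₀)))))
      where
      e : ℚ
      e = ι 4 * a ^ 2 - ι 2 * a ^ 3 - 1ℚ
      e∈ : Integral e
      e∈ = Integral-- (Integral-- (Integral-* (Integral-ι 4) (Integral-^ 2 a∈)) (Integral-* (Integral-ι 2) (Integral-^ 3 a∈))) (Integral-ι 1)
      eq : (ι 2 * ι m + 1ℚ) * (e * term a m - ι 2 * a ^ 3 * term/₀ a m) ≡ ι 2 * a ^ 2 * c ^ 3 * (L₁ - M₁)
      eq = begin
        (ι 2 * ι m + 1ℚ) * (e * term a m - ι 2 * a ^ 3 * term/₀ a m)
          ≡⟨ telescope₁ a m (Unit-≢0 Unit-a) (Unit-≢0 Unit-a-1) ⟨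
        ι 2 * a ^ 2 * c ^ 3 * L₁ - a ^ 2 * (c ^ 2 + 1ℚ) * X - b ^ 2 * c ^ 2 * Y
          ≡⟨ cong₂ (λ u v → ι 2 * a ^ 2 * c ^ 3 * L₁ - a ^ 2 * u * X - v * c ^ 2 * Y)
               (÷₀-cancel-Unit (c ^ 2 + 1ℚ) Unit-2c³) (÷₀-cancel-Unit (b ^ 2) Unit-2a²c) ⟨
        ι 2 * a ^ 2 * c ^ 3 * L₁ - a ^ 2 * (q₅ * (ι 2 * c ^ 3)) * X - q₆ * (ι 2 * a ^ 2 * c) * c ^ 2 * Y
          ≡⟨ solve 7 (λ a c L X Y q r → let two = con (ι 2) in
               two :* a :^ 2 :* c :^ 3 :* L :- a :^ 2 :* (q :* (two :* c :^ 3)) :* X :- r :* (two :* a :^ 2 :* c) :* c :^ 2 :* Y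
               := two :* a :^ 2 :* c :^ 3 :* (L :- (q :* X :+ r :* Y))) refl a c L₁ X Y q₅ q₆ ⟩
        ι 2 * a ^ 2 * c ^ 3 * (L₁ - M₁) ∎

    -- The relation behind `M₀-R₀` serves again, now multiplied by (a - 1)² to match the common
    -- denominator 2a² (a - 1)³.
    M₁-R₁ : Multiple 3 (M₁ - R₁)
    M₁-R₁ = Multiple-cancel (ι 2 * a ^ 2 * c ^ 3) Unit-2a²c³
      (subst (Multiple 3) eq (Multiple-*ˡ (Integral-^ 2 (Integral-- a∈ (Integral-ι 1))) Multiple-telescope-S))
      where
      expand : ℚ → ℚ → ℚ → ℚ → ℚ
      expand u v w z = a ^ 2 * u * X + v * c ^ 2 * Y - a * c ^ 2 * w * T + a * z * X
      eq : c ^ 2 * (a * b * X + b ^ 2 * Y - a * b * T) ≡ ι 2 * a ^ 2 * c ^ 3 * (M₁ - R₁)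
      eq = begin
        c ^ 2 * (a * b * X + b ^ 2 * Y - a * b * T)
          -- The coefficient of X splits as a (a + 1) c² = a² (c² + 1) + a (a² - 3a + 1), which is
          -- the origin of the quadratic in `q₈`.
          ≡⟨ solve 4 (λ a X Y T → let b = a :+ con 1ℚ; c = a :- con 1ℚ in
               c :^ 2 :* (a :* b :* X :+ b :^ 2 :* Y :- a :* b :* T)
               := a :^ 2 :* (c :^ 2 :+ con 1ℚ) :* X :+ b :^ 2 :* c :^ 2 :* Y
                  :- a :* c :^ 2 :* b :* T :+ a :* (a :^ 2 :- con (ι 3) :* a :+ con 1ℚ) :* X) refl a X Y T ⟩
        expand (c ^ 2 + 1ℚ) (b ^ 2) b d
          ≡⟨ cong₂ (λ u v → expand u v b d) (÷₀-cancel-Unit (c ^ 2 + 1ℚ) Unit-2c³) (÷₀-cancel-Unit (b ^ 2) Unit-2a²c) ⟨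
        expand u v b d
          ≡⟨ cong₂ (expand u v) (÷₀-cancel-Unit b Unit-2ac) (÷₀-cancel-Unit d Unit-2ac³) ⟨
        expand u v (q₇ * (ι 2 * a * c)) (q₈ * (ι 2 * a * c ^ 3))
          ≡⟨ solve 9 (λ a c X Y T q₅ q₆ q₇ q₈ → let two = con (ι 2) in
               a :^ 2 :* (q₅ :* (two :* c :^ 3)) :* X :+ q₆ :* (two :* a :^ 2 :* c) :* c :^ 2 :* Y
               :- a :* c :^ 2 :* (q₇ :* (two :* a :* c)) :* T :+ a :* (q₈ :* (two :* a :* c :^ 3)) :* X
               := two :* a :^ 2 :* c :^ 3 :* (q₅ :* X :+ q₆ :* Y :- (q₇ :* T :- q₈ :* X))) refl a c X Y T q₅ q₆ q₇ q₈ ⟩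
        ι 2 * a ^ 2 * c ^ 3 * (M₁ - R₁) ∎
        where
        d = a ^ 2 - ι 3 * a + 1ℚ
        u = q₅ * (ι 2 * c ^ 3)
        v = q₆ * (ι 2 * a ^ 2 * c)

    congruences : (L₀ ≡ M₀ [mod p ^ 3 ] × M₀ ≡ R₀ [mod p ^ 3 ])
                  × (L₁ ≡ M₁ [mod p ^ 3 ] × M₁ ≡ R₁ [mod p ^ 3 ])
    congruences = (≡-mod-fromʳ L₀ M₀ Integral-M₀ L₀-M₀ , ≡-mod-fromˡ M₀ R₀ Integral-M₀ M₀-R₀)
                , (≡-mod-fromʳ L₁ M₁ Integral-M₁ L₁-M₁ , ≡-mod-fromˡ M₁ R₁ Integral-M₁ M₁-R₁)

theorem12p1 :
    (p : ℕ) → Prime p → p ≢ 2 →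
    (a : ℚ) → a ∈ℤ₍ p ₎ →
    ¬ (a ≡ 0ℚ [mod p ^ 1 ]) →
    ¬ (a ≡ 1ℚ [mod p ^ 1 ]) →
    ¬ (a ≡ - 1ℚ [mod p ^ 1 ]) →
    let T = ∑[ k < p ∸ 1 ] (term a k ÷₀ ι (suc k))
        L₀ = ∑[ k < p ] term/₀ a k
        M₀ = (1ℚ ÷₀ (ι 2 * a)) * S p a
             + ((a + 1ℚ) ^ 2 ÷₀ (ι 2 * a ^ 3)) * S p (a + 1ℚ)
        R₀ = ((a + 1ℚ) ÷₀ (ι 2 * a ^ 2)) * T
             - (1ℚ ÷₀ (ι 2 * a ^ 2)) * S p a
        L₁ = ∑[ k < p ] term/₁ a k
        M₁ = (((a - 1ℚ) ^ 2 + 1ℚ) ÷₀ (ι 2 * (a - 1ℚ) ^ 3)) * S p a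
             + ((a + 1ℚ) ^ 2 ÷₀ (ι 2 * a ^ 2 * (a - 1ℚ))) * S p (a + 1ℚ)
        R₁ = ((a + 1ℚ) ÷₀ (ι 2 * a * (a - 1ℚ))) * T
             - ((a ^ 2 - ι 3 * a + 1ℚ) ÷₀ (ι 2 * a * (a - 1ℚ) ^ 3)) * S p a
    in (L₀ ≡ M₀ [mod p ^ 3 ] × M₀ ≡ R₀ [mod p ^ 3 ])
       × (L₁ ≡ M₁ [mod p ^ 3 ] × M₁ ≡ R₁ [mod p ^ 3 ])
theorem12p1 zero    p-prime = contradiction (prime⇒nonZero p-prime) λ ()
theorem12p1 (suc m) p-prime p≢2 a a∈ a≢0 a≢1 a≢-1 = congruences a (integral a∈)
  (λ h → ¬Multiple-from a 0ℚ a≢0 (Integral-ι 0) (subst (Multiple 1) (sym (+-identityʳ a)) h))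
  (¬Multiple-from a 1ℚ a≢1 (Integral-ι 1))
  -- Negating `- 1ℚ` evaluates to `1ℚ`, so the difference a - (-1) is a + 1 by computation.
  (¬Multiple-from a (- 1ℚ) a≢-1 (Integral-neg (Integral-ι 1)))
  where
  open OddPrime m p-prime p≢2
  open Localization (suc m) p-prime
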